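{- Let $G$ and $H$ be connected graphs, each of order at least $2$. The direct product $G \times H$ is well-dominated if and only if $G\times H=K_3\times K_3$, or $G\times H=K_2\times C_4$, or $G \times H=K_2 \times (F \odot K_1)$ for some connected graph $F$.
   Context: All graphs are finite, simple and undirected. A set $D\subseteq V(X)$ is a dominating set of a graph $X$ if every vertex of $X$ is in $D$ or adjacent to a vertex of $D$; it is a minimal dominating set if no proper subset is dominating. $\gamma(X)$ is the minimum cardinality of a dominating set and $\Gamma(X)$ the maximum cardinality of a minimal dominating set. $X$ is well-dominated if $\gamma(X)=\Gamma(X)$, i.e. every minimal dominating set is a minimum dominating set. The direct product $G\times H$ has vertex set $V(G)\times V(H)$, with $(g_1,h_1)$ adjacent to $(g_2,h_2)$ iff $g_1g_2\in E(G)$ and $h_1h_2\in E(H)$. The corona $F\odot K_1$ is obtained from $F$ by adding, for each vertex $u$ of $F$, a new vertex $u'$ and a new edge $uu'$. $C_4$ is the $4$-cycle and $K_n$ the complete graph of order $n$. Equalities of products are up to isomorphism (products are commutative). -}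

module Defs where

open import Data.Nat using (ℕ; zero; suc; _+_; _*_; _≤_; _%_)
open import Data.Bool using (Bool; true; false; _∧_; _∨_; not)
open import Data.Nat.Properties using () renaming (_≟_ to _ℕ≟_)
open import Data.Bool.Properties using (∨-comm)
open import Data.Fin using (Fin; zero; suc; toℕ; _≟_; remQuot; splitAt)
open import Data.Fin.Subset using (Subset; _∈_; _⊂_; ∣_∣)
open import Data.Sum using (_⊎_; inj₁; inj₂)
open import Data.Product using (Σ; ∃; _×_; _,_)
open import Relation.Nullary using (¬_; yes; no)
open import Relation.Nullary.Decidable using (⌊_⌋)
open import Relation.Binary.PropositionalEquality using (_≡_; refl; sym; cong; cong₂)
open import Data.Empty using (⊥-elim)

record Graph : Set where
  field
    order  : ℕ
    adj    : Fin order → Fin order → Bool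
    adj-sym    : ∀ u v → adj u v ≡ adj v u
    adj-irrefl : ∀ u → adj u u ≡ false
open Graph public

data Reach (X : Graph) (u : Fin (order X)) : Fin (order X) → Set where
  here : Reach X u u
  step : ∀ {v w} → Reach X u v → adj X v w ≡ true → Reach X u w

Connected : Graph → Set
Connected X = ∀ u v → Reach X u v

Dominates : (X : Graph) → Subset (order X) → Fin (order X) → Set
Dominates X D v = v ∈ D ⊎ ∃ λ u → u ∈ D × adj X u v ≡ true

Dominating : (X : Graph) → Subset (order X) → Set
Dominating X D = ∀ v → Dominates X D v

MinimalDominating : (X : Graph) → Subset (order X) → Set
MinimalDominating X D = Dominating X D × (∀ D' → D' ⊂ D → ¬ Dominating X D')

MinimumDominating : (X : Graph) → Subset (order X) → Set
MinimumDominating X D = Dominating X D × (∀ D' → Dominating X D' → ∣ D ∣ ≤ ∣ D' ∣)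

-- well-dominated: every minimal dominating set is a minimum dominating set
-- (equivalently γ = Γ)
WellDominated : Graph → Set
WellDominated X = ∀ D → MinimalDominating X D → MinimumDominating X D

record _≅_ (X Y : Graph) : Set where
  field
    to   : Fin (order X) → Fin (order Y)
    from : Fin (order Y) → Fin (order X)
    from-to : ∀ u → from (to u) ≡ u
    to-from : ∀ v → to (from v) ≡ v
    preserves : ∀ u v → adj Y (to u) (to v) ≡ adj X u v

≟-sym : ∀ {n} (i j : Fin n) → ⌊ i ≟ j ⌋ ≡ ⌊ j ≟ i ⌋
≟-sym i j with i ≟ j | j ≟ i
... | yes _ | yes _ = refl
... | no _  | no _  = refl
... | yes p | no q  = ⊥-elim (q (sym p))
... | no q  | yes p = ⊥-elim (q (sym p))

≟-refl : ∀ {n} (i : Fin n) → ⌊ i ≟ i ⌋ ≡ true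
≟-refl i with i ≟ i
... | yes _ = refl
... | no q = ⊥-elim (q refl)

K : ℕ → Graph
K n = record { order = n ; adj = λ i j → not ⌊ i ≟ j ⌋
             ; adj-sym = λ i j → cong not (≟-sym i j)
             ; adj-irrefl = λ i → cong not (≟-refl i) }

c4e : Fin 4 → Fin 4 → Bool
c4e i j = ⌊ suc (toℕ i) % 4 ℕ≟ toℕ j ⌋

c4irr : ∀ i → c4e i i ∨ c4e i i ≡ false
c4irr zero = refl
c4irr (suc zero) = refl
c4irr (suc (suc zero)) = refl
c4irr (suc (suc (suc zero))) = refl

C4 : Graph
C4 = record { order = 4 ; adj = λ i j → c4e i j ∨ c4e j i
            ; adj-sym = λ i j → ∨-comm (c4e i j) (c4e j i)
            ; adj-irrefl = c4irr }

-- direct (tensor) product; vertex (g , h) is encoded by combine g h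
padj : (G H : Graph) → Fin (order G) × Fin (order H) → Fin (order G) × Fin (order H) → Bool
padj G H (a , b) (c , d) = adj G a c ∧ adj H b d

padj-sym : ∀ G H p q → padj G H p q ≡ padj G H q p
padj-sym G H (a , b) (c , d) = cong₂ _∧_ (adj-sym G a c) (adj-sym H b d)

padj-irr : ∀ G H p → padj G H p p ≡ false
padj-irr G H (a , b) = cong₂ _∧_ (adj-irrefl G a) refl

_×ᵍ_ : Graph → Graph → Graph
G ×ᵍ H = record
  { order = order G * order H
  ; adj = λ i j → padj G H (remQuot (order H) i) (remQuot (order H) j)
  ; adj-sym = λ i j → padj-sym G H (remQuot (order H) i) (remQuot (order H) j)
  ; adj-irrefl = λ i → padj-irr G H (remQuot (order H) i) }

-- corona F ⊙ K₁: vertices Fin (n + n); the first n are the vertices of F,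
-- vertex n + u is the new pendant vertex u' attached to u.
cadj : (F : Graph) → Fin (order F) ⊎ Fin (order F) → Fin (order F) ⊎ Fin (order F) → Bool
cadj F (inj₁ u) (inj₁ v) = adj F u v
cadj F (inj₁ u) (inj₂ v) = ⌊ u ≟ v ⌋
cadj F (inj₂ u) (inj₁ v) = ⌊ u ≟ v ⌋
cadj F (inj₂ u) (inj₂ v) = false

cadj-sym : ∀ F p q → cadj F p q ≡ cadj F q p
cadj-sym F (inj₁ u) (inj₁ v) = adj-sym F u v
cadj-sym F (inj₁ u) (inj₂ v) = ≟-sym u v
cadj-sym F (inj₂ u) (inj₁ v) = ≟-sym u v
cadj-sym F (inj₂ u) (inj₂ v) = refl

cadj-irr : ∀ F p → cadj F p p ≡ false
cadj-irr F (inj₁ u) = adj-irrefl F u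
cadj-irr F (inj₂ u) = refl

Corona : Graph → Graph
Corona F = record
  { order = order F + order F
  ; adj = λ i j → cadj F (splitAt (order F) i) (splitAt (order F) j)
  ; adj-sym = λ i j → cadj-sym F (splitAt (order F) i) (splitAt (order F) j)
  ; adj-irrefl = λ i → cadj-irr F (splitAt (order F) i) }

{-# OPTIONS --safe #-}
-- Only one consequence of well-domination is needed: a maximal independent set of G × H is no larger
-- than any dominating set (the product is then called tight).  Tightness passes to R × V(H), where R is
-- the residual graph G − N[I] of an independent set I.  If I is maximal with the property that R has
-- an edge, then non-adjacency is transitive in R, i.e. R is complete multipartite.  Comparing small
-- dominating sets with maximal independent sets in the product of two such residual graphs shows that
-- both are triangles or that one of them, say R, is a single edge.
--
-- If R is a triangle, every maximal independent set J of H satisfies |V(H)| = 3|J|.  If some vertex had two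
-- neighbours in J, then every x ∈ J would have two private neighbours, giving |V(H)| > 3|J|.  Hence H has
-- no induced path on three vertices, so H = K₃.
--
-- If R is an edge ab, every dominating set {a} × P ∪ {b} × Q has at least |V(H)| elements.  It follows
-- that all neighbours of a vertex without a leaf neighbour have the same neighbourhood, and so H is K₂, C₄ or
-- a corona.  If H ≠ K₂, it has a total dominating set T and a maximal independent set J with |T| ≤ |J|;
-- a connected G with at least three vertices has a total dominating set omitting a vertex x, and
-- (V(G) ∖ {x}) × T is smaller than V(G) × J.  So G = K₂.
module Submission where

open import Defs
open import Data.Nat
  using (ℕ; zero; suc; _+_; _*_; _≤_; _<_; _≤?_; z≤n; s≤s)
open import Data.Nat.Properties
  using (*-cancelˡ-≤; *-identityʳ; *-identityˡ; *-mono-≤; *-monoʳ-≤; *-monoˡ-≤; *-zeroʳ; +-assoc;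
    +-cancelʳ-≤; +-cancelˡ-≤; +-comm; +-identityʳ; +-mono-≤; +-monoʳ-≤; +-monoˡ-≤; +-suc; 1+n≰n;
    <-irrefl; <-≤-trans; <⇒≱; m≤m+n; m≤n+m; n≤1+n; ≤-antisym; ≤-refl; ≤-reflexive; ≤-trans; ≤∧≢⇒<;
    module ≤-Reasoning)
import Data.Nat.Properties as ℕ
open import Data.Nat.Solver using (module +-*-Solver)
open import Algebra.Properties.Semiring.Sum ℕ.+-*-semiring
  using (sum; sum-cong-≗; ∑-distrib-+; ∑-comm; *-distribˡ-sum; *-distribʳ-sum)
open import Data.Bool using (Bool; true; false; not; _∧_)
open import Data.Bool.Properties using (¬-not; ∧-comm)
import Data.Bool.Properties as Bool
open import Data.Fin
  using (Fin; zero; suc; _≟_; combine; remQuot; splitAt; join; _↑ˡ_; _↑ʳ_)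
open import Data.Fin.Properties using (any?; all?; remQuot-combine; combine-remQuot; splitAt-join; join-splitAt)
open import Data.Fin.Subset using (Subset; _∈_; _∉_; _⊂_; ∣_∣; _∪_; _-_; ⁅_⁆) renaming (⊥ to ∅)
open import Data.Fin.Subset.Properties
  using (_∈?_; drop-there; p⊂q⇒∣p∣<∣q∣; p⊆p∪q; q⊆p∪q; x∈⁅x⁆; ∣p∣≤n; x∈p∪q⁻; x∈⁅y⁆⇒x≡y; ∉⊥; anySubset?; x∈p⇒p-x⊂p)
open import Data.Vec using ([]; _∷_; there; tabulate)
open import Data.Vec.Properties using (lookup∘tabulate; lookup⇒[]=; []=⇒lookup)
open import Data.List using (List; []; _∷_; length; lookup; filter; allFin)
open import Data.List.Membership.Propositional using () renaming (_∈_ to _∈ˡ_)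
open import Data.List.Membership.DecPropositional using () renaming (_∈?_ to _∈ˡ?_)
open import Data.List.Membership.Propositional.Properties using (∈-lookup; ∈-filter⁺; ∈-filter⁻; ∈-allFin)
open import Data.List.Relation.Unary.Any using (here; there; index)
open import Data.List.Relation.Unary.Any.Properties using (lookup-index)
open import Data.List.Relation.Unary.All as All using (All; []; _∷_)
open import Data.List.Relation.Unary.All.Properties using (¬Any⇒All¬)
open import Data.List.Relation.Unary.Unique.Propositional using (Unique; []; _∷_)
import Data.List.Relation.Unary.Unique.Propositional.Properties as Unique
open import Data.Product using (Σ; ∃; ∃₂; _×_; _,_; proj₁; proj₂; uncurry; swap)
open import Data.Sum using (_⊎_; inj₁; inj₂; [_,_]′)
open import Data.Unit using (tt)
open import Data.Empty using (⊥-elim)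
open import Relation.Unary using (U)
open import Relation.Nullary using (¬_; Dec; yes; no; does; contradiction)
open import Relation.Nullary.Decidable using (_×-dec_; _⊎-dec_; _→-dec_; ¬?; dec-true; decidable-stable; ⌊_⌋; from-no)
open import Relation.Binary.PropositionalEquality
  using (_≡_; _≢_; refl; sym; trans; cong; cong₂; subst; subst₂; ≢-sym)
open import Function using (_∘_; case_of_)
open import Function.Bundles using (_⇔_; mk⇔)

private
  variable
    n m : ℕ

-- Counting

sum-mono : {f g : Fin n → ℕ} → (∀ i → f i ≤ g i) → sum f ≤ sum g
sum-mono {zero} f≤g = z≤n
sum-mono {suc n} f≤g = +-mono-≤ (f≤g zero) (sum-mono (λ i → f≤g (suc i)))

sum-≥-term : (f : Fin n → ℕ) (i : Fin n) → f i ≤ sum f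
sum-≥-term f zero = m≤m+n _ _
sum-≥-term f (suc i) = ≤-trans (sum-≥-term (f ∘ suc) i) (m≤n+m _ _)

sum-zero : (f : Fin n → ℕ) → (∀ i → f i ≡ 0) → sum f ≡ 0
sum-zero {zero} f f≡0 = refl
sum-zero {suc n} f f≡0 = cong₂ _+_ (f≡0 zero) (sum-zero (f ∘ suc) (λ i → f≡0 (suc i)))

sum-≤-term : (f : Fin n → ℕ) (i : Fin n) → (∀ j → j ≢ i → f j ≡ 0) → sum f ≤ f i
sum-≤-term {suc n} f zero f≡0
  rewrite sum-zero (f ∘ suc) (λ j → f≡0 (suc j) (λ ())) = ≤-reflexive (+-identityʳ _)
sum-≤-term {suc n} f (suc i) f≡0
  rewrite f≡0 zero (λ ()) = sum-≤-term (f ∘ suc) i (λ j j≢i → f≡0 (suc j) (λ { refl → j≢i refl }))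

sum-↑ : (f : Fin (n + m) → ℕ) → sum f ≡ sum (λ i → f (i ↑ˡ m)) + sum (λ j → f (n ↑ʳ j))
sum-↑ {zero} f = refl
sum-↑ {suc n} {m} f = trans (cong (f zero +_) (sum-↑ {n} {m} (f ∘ suc)))
  (sym (+-assoc (f zero) _ _))

sum-combine : (f : Fin (n * m) → ℕ) → sum f ≡ sum (λ i → sum (λ j → f (combine {n} {m} i j)))
sum-combine {zero} f = refl
sum-combine {suc n} {m} f = trans (sum-↑ {m} {n * m} f) (cong (sum (λ j → f (j ↑ˡ (n * m))) +_) (sum-combine {n} {m} _))

𝟙 : {P : Set} → Dec P → ℕ
𝟙 (yes _) = 1
𝟙 (no _) = 0

𝟙≤1 : {P : Set} (P? : Dec P) → 𝟙 P? ≤ 1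
𝟙≤1 (yes _) = ≤-refl
𝟙≤1 (no _) = z≤n

𝟙-true : {P : Set} (P? : Dec P) → P → 1 ≤ 𝟙 P?
𝟙-true (yes _) p = ≤-refl
𝟙-true (no ¬p) p = contradiction p ¬p

𝟙-false : {P : Set} (P? : Dec P) → ¬ P → 𝟙 P? ≡ 0
𝟙-false (yes p) ¬p = contradiction p ¬p
𝟙-false (no _) _ = refl

𝟙-mono : {P Q : Set} (P? : Dec P) (Q? : Dec Q) → (P → Q) → 𝟙 P? ≤ 𝟙 Q?
𝟙-mono (yes p) Q? f = 𝟙-true Q? (f p)
𝟙-mono (no _) Q? f = z≤n

𝟙-× : {P Q : Set} (P? : Dec P) (Q? : Dec Q) → 𝟙 (P? ×-dec Q?) ≡ 𝟙 P? * 𝟙 Q?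
𝟙-× (yes p) (yes q) = refl
𝟙-× (yes p) (no _) = refl
𝟙-× (no _) Q? = refl

𝟙-cover : {P Q R : Set} (P? : Dec P) (Q? : Dec Q) (R? : Dec R) → (R → P ⊎ Q) → 𝟙 R? ≤ 𝟙 P? + 𝟙 Q?
𝟙-cover P? Q? (no _) f = z≤n
𝟙-cover P? Q? (yes r) f with f r
... | inj₁ p = ≤-trans (𝟙-true P? p) (m≤m+n _ _)
... | inj₂ q = ≤-trans (𝟙-true Q? q) (m≤n+m _ _)

𝟙-disjoint : {P Q R : Set} (P? : Dec P) (Q? : Dec Q) (R? : Dec R) →
  (P → R) → (Q → R) → (P → ¬ Q) → 𝟙 P? + 𝟙 Q? ≤ 𝟙 R?
𝟙-disjoint (yes p) (yes q) R? f g d = contradiction q (d p)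
𝟙-disjoint (yes p) (no _) R? f g d = 𝟙-true R? (f p)
𝟙-disjoint (no _) Q? R? f g d = 𝟙-mono Q? R? g

# : {P : Fin n → Set} → (∀ i → Dec (P i)) → ℕ
# P? = sum (λ i → 𝟙 (P? i))

U? : ∀ n (i : Fin n) → Dec (U i)
U? _ _ = yes tt

#U : # (U? n) ≡ n
#U {zero} = refl
#U {suc n} = cong suc #U

module _ {P Q R : Fin n → Set} (P? : ∀ i → Dec (P i)) (Q? : ∀ i → Dec (Q i)) (R? : ∀ i → Dec (R i)) where

  #-cover : (∀ {i} → R i → P i ⊎ Q i) → # R? ≤ # P? + # Q?
  #-cover f = ≤-trans (sum-mono (λ i → 𝟙-cover (P? i) (Q? i) (R? i) f)) (≤-reflexive (∑-distrib-+ (λ i → 𝟙 (P? i)) (λ i → 𝟙 (Q? i))))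

  #-disjoint : (∀ {i} → P i → R i) → (∀ {i} → Q i → R i) → (∀ {i} → P i → ¬ Q i) → # P? + # Q? ≤ # R?
  #-disjoint f g d = ≤-trans (≤-reflexive (sym (∑-distrib-+ (λ i → 𝟙 (P? i)) (λ i → 𝟙 (Q? i)))))
    (sum-mono (λ i → 𝟙-disjoint (P? i) (Q? i) (R? i) f g d))

#-mono : {P Q : Fin n → Set} (P? : ∀ i → Dec (P i)) (Q? : ∀ i → Dec (Q i)) → (∀ {i} → P i → Q i) → # P? ≤ # Q?
#-mono P? Q? f = sum-mono (λ i → 𝟙-mono (P? i) (Q? i) f)

#-≡ : (x : Fin n) → # (_≟ x) ≤ 1
#-≡ x = ≤-trans (sum-≤-term _ x (λ j j≢x → 𝟙-false (j ≟ x) j≢x)) (𝟙≤1 (x ≟ x))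

#-≥1 : {P : Fin n → Set} (P? : ∀ i → Dec (P i)) {x : Fin n} → P x → 1 ≤ # P?
#-≥1 P? {x} p = ≤-trans (𝟙-true (P? x) p) (sum-≥-term _ x)

#-≤-list : {P : Fin n → Set} (P? : ∀ i → Dec (P i)) (xs : List (Fin n)) → (∀ {i} → P i → i ∈ˡ xs) → # P? ≤ length xs
#-≤-list P? [] f = ≤-reflexive (sum-zero _ (λ i → 𝟙-false (P? i) (λ p → case f p of λ ())))
#-≤-list {P = P} P? (x ∷ xs) f =
  ≤-trans (#-cover (_≟ x) P′? P? (λ {i} p → case i ≟ x of λ { (yes e) → inj₁ e ; (no ne) → inj₂ (p , ne) }))
          (+-mono-≤ (#-≡ x) (#-≤-list P′? xs (λ { (p , ne) → case f p of λ { (here e) → contradiction e ne ; (there q) → q } })))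
  where
  P′? : ∀ i → Dec (P i × i ≢ x)
  P′? i = P? i ×-dec ¬? (i ≟ x)

#-≥-list : {P : Fin n → Set} (P? : ∀ i → Dec (P i)) {xs : List (Fin n)} → Unique xs → All P xs → length xs ≤ # P?
#-≥-list P? [] [] = z≤n
#-≥-list {P = P} P? {x ∷ xs} (x∉xs ∷ uxs) (p ∷ ps) =
  ≤-trans (+-mono-≤ (#-≥1 (_≟ x) refl) (#-≥-list P′? uxs (All.zipWith (λ (q , ne) → q , ≢-sym ne) (ps , x∉xs))))
          (#-disjoint (_≟ x) P′? P? (λ { refl → p }) proj₁ (λ e (_ , ne) → ne e))
  where
  P′? : ∀ i → Dec (P i × i ≢ x)
  P′? i = P? i ×-dec ¬? (i ≟ x)

-- Double counting of a relation in which every i ∈ P has k partners and every j has at most one.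
#-relation : {P : Fin n → Set} {Q : Fin m → Set} {R : Fin n → Fin m → Set}
  (P? : ∀ i → Dec (P i)) (Q? : ∀ j → Dec (Q j)) (R? : ∀ i j → Dec (R i j)) (k : ℕ) →
  (∀ {i} → P i → k ≤ # (R? i)) → (∀ {i j} → P i → R i j → Q j) →
  (∀ {i i′ j} → P i → P i′ → R i j → R i′ j → i ≡ i′) → k * # P? ≤ # Q?
#-relation {P = P} {Q} {R} P? Q? R? k large into functional = begin
  k * # P?                                             ≡⟨ *-distribˡ-sum k (λ i → 𝟙 (P? i)) ⟩
  sum (λ i → k * 𝟙 (P? i))                             ≤⟨ sum-mono row ⟩
  sum (λ i → sum (λ j → 𝟙 (P? i ×-dec R? i j)))        ≡⟨ ∑-comm (λ i j → 𝟙 (P? i ×-dec R? i j)) ⟩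
  sum (λ j → sum (λ i → 𝟙 (P? i ×-dec R? i j)))        ≤⟨ sum-mono column ⟩
  # Q?                                                 ∎
  where
  open ≤-Reasoning
  row : ∀ i → k * 𝟙 (P? i) ≤ sum (λ j → 𝟙 (P? i ×-dec R? i j))
  row i with P? i
  ... | no _ = ≤-trans (≤-reflexive (*-zeroʳ k)) z≤n
  ... | yes p = ≤-trans (≤-reflexive (*-identityʳ k))
      (≤-trans (large p) (sum-mono (λ j → 𝟙-mono (R? i j) (yes p ×-dec R? i j) (p ,_))))
  column : ∀ j → sum (λ i → 𝟙 (P? i ×-dec R? i j)) ≤ 𝟙 (Q? j)
  column j with any? (λ i → P? i ×-dec R? i j)
  ... | no none = ≤-trans (≤-reflexive (sum-zero _ (λ i → 𝟙-false (P? i ×-dec R? i j) (λ pr → none (i , pr))))) z≤n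
  ... | yes (i , p , r) =
      ≤-trans (sum-≤-term _ i (λ i′ i′≢i → 𝟙-false (P? i′ ×-dec R? i′ j) (λ (p′ , r′) → i′≢i (functional p′ p r′ r))))
              (𝟙-mono (P? i ×-dec R? i j) (Q? j) (λ (p , r) → into p r))

#-there : ∀ {b} (D : Subset n) → # (_∈? D) ≡ # (λ i → suc i ∈? b ∷ D)
#-there D = sum-cong-≗ (λ i → ≤-antisym (𝟙-mono (i ∈? D) (suc i ∈? _ ∷ D) there)
                                        (𝟙-mono (suc i ∈? _ ∷ D) (i ∈? D) drop-there))

∣∣≡# : (D : Subset n) → ∣ D ∣ ≡ # (_∈? D)
∣∣≡# [] = refl
∣∣≡# (true ∷ D) = cong suc (trans (∣∣≡# D) (#-there D))
∣∣≡# (false ∷ D) = trans (∣∣≡# D) (#-there D)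

-- Counting vertex sets of a product

## : {M : Fin n → Fin m → Set} → (∀ i j → Dec (M i j)) → ℕ
## M? = sum (λ i → # (M? i))

module _ {P Q R : Fin n → Fin m → Set} (P? : ∀ i j → Dec (P i j)) (Q? : ∀ i j → Dec (Q i j)) (R? : ∀ i j → Dec (R i j)) where

  ##-cover : (∀ {i j} → R i j → P i j ⊎ Q i j) → ## R? ≤ ## P? + ## Q?
  ##-cover f = ≤-trans (sum-mono (λ i → #-cover (P? i) (Q? i) (R? i) f)) (≤-reflexive (∑-distrib-+ (λ i → # (P? i)) (λ i → # (Q? i))))

  ##-disjoint : (∀ {i j} → P i j → R i j) → (∀ {i j} → Q i j → R i j) → (∀ {i j} → P i j → ¬ Q i j) → ## P? + ## Q? ≤ ## R?
  ##-disjoint f g d = ≤-trans (≤-reflexive (sym (∑-distrib-+ (λ i → # (P? i)) (λ i → # (Q? i)))))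
    (sum-mono (λ i → #-disjoint (P? i) (Q? i) (R? i) f g d))

##-swap : {M : Fin n → Fin m → Set} (M? : ∀ i j → Dec (M i j)) → ## M? ≡ ## (λ j i → M? i j)
##-swap M? = ∑-comm (λ i j → 𝟙 (M? i j))

_⊠?_ : {P : Fin n → Set} {Q : Fin m → Set} → (∀ i → Dec (P i)) → (∀ j → Dec (Q j)) → ∀ i j → Dec (P i × Q j)
(P? ⊠? Q?) i j = P? i ×-dec Q? j

##-⊠ : {P : Fin n → Set} {Q : Fin m → Set} (P? : ∀ i → Dec (P i)) (Q? : ∀ j → Dec (Q j)) → ## (P? ⊠? Q?) ≡ # P? * # Q?
##-⊠ P? Q? = trans
  (sum-cong-≗ (λ i → trans (sum-cong-≗ (λ j → 𝟙-× (P? i) (Q? j))) (sym (*-distribˡ-sum (𝟙 (P? i)) (λ j → 𝟙 (Q? j))))))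
  (sym (*-distribʳ-sum (# Q?) (λ i → 𝟙 (P? i))))

-- Tight products

subset : {P : Fin n → Set} → (∀ i → Dec (P i)) → Subset n
subset P? = tabulate (λ i → does (P? i))

module _ {P : Fin n → Set} (P? : ∀ i → Dec (P i)) where

  ∈-subset⁺ : ∀ {i} → P i → i ∈ subset P?
  ∈-subset⁺ {i} p = lookup⇒[]= i _ (trans (lookup∘tabulate _ i) (dec-true (P? i) p))

  ∈-subset⁻ : ∀ {i} → i ∈ subset P? → P i
  ∈-subset⁻ {i} i∈ with P? i | trans (sym (lookup∘tabulate (λ i → does (P? i)) i)) ([]=⇒lookup i∈)
  ... | yes p | _ = p

  ∣subset∣ : ∣ subset P? ∣ ≡ # P?
  ∣subset∣ = trans (∣∣≡# (subset P?)) (≤-antisym (#-mono _ P? ∈-subset⁻) (#-mono P? _ ∈-subset⁺))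

Vertex : Graph → Set
Vertex G = Fin (order G)

E : (G : Graph) → Vertex G → Vertex G → Set
E G u v = adj G u v ≡ true

E? : (G : Graph) → ∀ u v → Dec (E G u v)
E? G u v = adj G u v Bool.≟ true

E-sym : (G : Graph) → ∀ {u v} → E G u v → E G v u
E-sym G {u} {v} e = trans (adj-sym G v u) e

E-irrefl : (G : Graph) → ∀ {u} → ¬ E G u u
E-irrefl G {u} e = case trans (sym e) (adj-irrefl G u) of λ ()

E⇒≢ : (G : Graph) → ∀ {u v} → E G u v → u ≢ v
E⇒≢ G e refl = E-irrefl G e

-- M and D range over sets of vertices of the direct product, in curried form.
Independent₂ : (G H : Graph) → (Vertex G → Vertex H → Set) → Set
Independent₂ G H M = ∀ {g h g′ h′} → M g h → M g′ h′ → E G g g′ → ¬ E H h h′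

Dominates₂ : (G H : Graph) → (Vertex G → Vertex H → Set) → Vertex G → Vertex H → Set
Dominates₂ G H D g h = D g h ⊎ ∃₂ λ g′ h′ → D g′ h′ × E G g′ g × E H h′ h

-- In the subgraph of G × H induced by R × S, maximal independent sets are no larger
-- than dominating sets.  The dominating set may use vertices outside R × S.
Tight : (G H : Graph) → (Vertex G → Set) → (Vertex H → Set) → Set₁
Tight G H R S = {M D : Vertex G → Vertex H → Set} (M? : ∀ g h → Dec (M g h)) (D? : ∀ g h → Dec (D g h)) →
  (∀ {g h} → M g h → R g × S h) → Independent₂ G H M →
  (∀ {g h} → R g → S h → Dominates₂ G H M g h) →
  (∀ {g h} → R g → S h → Dominates₂ G H D g h) → ## M? ≤ ## D?

##≡# : {M : Fin n → Fin m → Set} (M? : ∀ g h → Dec (M g h)) → # (λ i → uncurry M? (remQuot {n} m i)) ≡ ## M?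
##≡# {n} {m} M? = trans (sum-combine {n} {m} _)
  (sum-cong-≗ (λ g → sum-cong-≗ (λ h → cong (λ p → 𝟙 (uncurry M? p)) (remQuot-combine g h))))

module _ (G H : Graph) where

  private
    rq : Fin (order G * order H) → Vertex G × Vertex H
    rq = remQuot (order H)

  E-×⁻ : ∀ {i j} → E (G ×ᵍ H) i j → E G (proj₁ (rq i)) (proj₁ (rq j)) × E H (proj₂ (rq i)) (proj₂ (rq j))
  E-×⁻ {i} {j} e with adj G (proj₁ (rq i)) (proj₁ (rq j)) | adj H (proj₂ (rq i)) (proj₂ (rq j)) | e
  ... | true | true | _ = refl , refl

  E-×⁺ : ∀ {i j} → E G (proj₁ (rq i)) (proj₁ (rq j)) → E H (proj₂ (rq i)) (proj₂ (rq j)) → E (G ×ᵍ H) i j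
  E-×⁺ = cong₂ _∧_

  dominating : {D : Vertex G → Vertex H → Set} (D? : ∀ g h → Dec (D g h)) →
    (∀ g h → Dominates₂ G H D g h) → Dominating (G ×ᵍ H) (subset (λ i → uncurry D? (rq i)))
  dominating {D} D? dom i with dom (proj₁ (rq i)) (proj₂ (rq i))
  ... | inj₁ d = inj₁ (∈-subset⁺ (λ i → uncurry D? (rq i)) d)
  ... | inj₂ (g , h , d , e₁ , e₂) = inj₂ (combine g h , ∈-subset⁺ (λ i → uncurry D? (rq i)) (subst (uncurry D) (sym eq) d) ,
      E-×⁺ {combine g h} {i} (subst (λ p → E G (proj₁ p) _) (sym eq) e₁) (subst (λ p → E H (proj₂ p) _) (sym eq) e₂))
    where eq = remQuot-combine g h

  -- A maximal independent set is a minimal dominating set, and well-domination turns it into a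
  -- minimum one.
  wellDominated⇒tight : WellDominated (G ×ᵍ H) → Tight G H U U
  wellDominated⇒tight wd M? D? _ indep domM domD =
    subst₂ _≤_ (card M?) (card D?)
      (proj₂ (wd (subset (λ i → uncurry M? (rq i))) (dominating M? (λ g h → domM tt tt) , minimal))
        _ (dominating D? (λ g h → domD tt tt)))
    where
    card : {M : Vertex G → Vertex H → Set} (M? : ∀ g h → Dec (M g h)) → ∣ subset (λ i → uncurry M? (rq i)) ∣ ≡ ## M?
    card M? = trans (∣subset∣ (λ i → uncurry M? (rq i))) (##≡# M?)
    -- A vertex of M missing from `D′` could be dominated only from another vertex of M, against
    -- independence.
    minimal : ∀ D′ → _ → ¬ Dominating (G ×ᵍ H) D′
    minimal D′ (D′⊆M , x , x∈M , x∉D′) dom′ with dom′ x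
    ... | inj₁ x∈D′ = x∉D′ x∈D′
    ... | inj₂ (u , u∈D′ , e) = indep (∈-subset⁻ (λ i → uncurry M? (rq i)) (D′⊆M u∈D′)) (∈-subset⁻ (λ i → uncurry M? (rq i)) x∈M)
        (proj₁ (E-×⁻ {u} {x} e)) (proj₂ (E-×⁻ {u} {x} e))

tight-swap : (G H : Graph) → ∀ {R S} → Tight G H R S → Tight H G S R
tight-swap G H tight M? D? M⊆ indep domM domD =
  subst₂ _≤_ (sym (##-swap M?)) (sym (##-swap D?))
    (tight (λ g h → M? h g) (λ g h → D? h g) (λ m → let s , r = M⊆ m in r , s)
      (λ m m′ e e′ → indep m m′ e′ e) (λ r s → flip-dom (domM s r)) (λ r s → flip-dom (domD s r)))
  where
  flip-dom : ∀ {D g h} → Dominates₂ H G D h g → Dominates₂ G H (λ g h → D h g) g h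
  flip-dom (inj₁ d) = inj₁ d
  flip-dom (inj₂ (h′ , g′ , d , e₁ , e₂)) = inj₂ (g′ , h′ , d , e₂ , e₁)

-- Residual graphs

Independent : (G : Graph) → (Vertex G → Set) → Set
Independent G I = ∀ {u v} → I u → I v → ¬ E G u v

NoIsolated : (G : Graph) → (Vertex G → Set) → Set
NoIsolated G S = ∀ {v} → S v → ∃ λ u → S u × E G u v

Residual : (G : Graph) → (Vertex G → Set) → Vertex G → Set
Residual G I v = ¬ I v × (∀ u → I u → ¬ E G u v)

residual? : (G : Graph) {I : Vertex G → Set} → (∀ v → Dec (I v)) → ∀ v → Dec (Residual G I v)
residual? G I? v = ¬? (I? v) ×-dec all? (λ u → I? u →-dec ¬? (E? G u v))

¬residual : (G : Graph) {I : Vertex G → Set} → (∀ v → Dec (I v)) → ∀ {v} → ¬ Residual G I v → I v ⊎ ∃ λ u → I u × E G u v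
¬residual G I? {v} ¬res with I? v
... | yes i = inj₁ i
... | no ¬i with any? (λ u → I? u ×-dec E? G u v)
...   | yes x = inj₂ x
...   | no none = contradiction (¬i , λ u i e → none (u , i , e)) ¬res

-- Adding I × S to both sets compares them inside the full product.
tight-residual : (G H : Graph) → ∀ {I S} (I? : ∀ g → Dec (I g)) (S? : ∀ h → Dec (S h)) →
  Independent G I → NoIsolated H S → Tight G H U S → Tight G H (Residual G I) S
tight-residual G H {I} {S} I? S? indI isoS tight {M} {D} M? D? M⊆ indep domM domD =
  +-cancelˡ-≤ (## B?) (## M?) (## D?) (begin
    ## B? + ## M?                      ≤⟨ ##-disjoint B? M? (B∪ M?) inj₁ inj₂ (λ (i , _) m → proj₁ (proj₁ (M⊆ m)) i) ⟩
    ## (B∪ M?)                         ≤⟨ tight (B∪ M?) (B∪ D?) [ (λ (_ , s) → tt , s) , (λ m → tt , proj₂ (M⊆ m)) ]′ ind (dom domM) (dom domD) ⟩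
    ## (B∪ D?)                         ≤⟨ ##-cover B? D? (B∪ D?) (λ x → x) ⟩
    ## B? + ## D?                      ∎)
  where
  open ≤-Reasoning
  B? = I? ⊠? S?
  B∪ : {N : Vertex G → Vertex H → Set} → (∀ g h → Dec (N g h)) → ∀ g h → Dec ((I g × S h) ⊎ N g h)
  B∪ N? g h = B? g h ⊎-dec N? g h
  ind : Independent₂ G H (λ g h → (I g × S h) ⊎ M g h)
  ind (inj₁ (i , _)) (inj₁ (i′ , _)) e _ = indI i i′ e
  ind (inj₁ (i , _)) (inj₂ m) e _ = proj₂ (proj₁ (M⊆ m)) _ i e
  ind (inj₂ m) (inj₁ (i , _)) e _ = proj₂ (proj₁ (M⊆ m)) _ i (E-sym G e)
  ind (inj₂ m) (inj₂ m′) e e′ = indep m m′ e e′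
  dom : {N : Vertex G → Vertex H → Set} → (∀ {g h} → Residual G I g → S h → Dominates₂ G H N g h) →
    ∀ {g h} → U g → S h → Dominates₂ G H (λ g h → (I g × S h) ⊎ N g h) g h
  dom domN {g} {h} _ s with residual? G I? g
  ... | yes r = [ inj₁ ∘ inj₂ , (λ (g′ , h′ , d , es) → inj₂ (g′ , h′ , inj₂ d , es)) ]′ (domN r s)
  ... | no ¬r with ¬residual G I? ¬r
  ...   | inj₁ i = inj₁ (inj₁ (i , s))
  -- Here g has a neighbour u in I, and pairing u with any neighbour of h in S gives a vertex of I ×
  -- S adjacent to (g , h).
  ...   | inj₂ (u , i , e) = let h′ , s′ , e′ = isoS s in inj₂ (u , h′ , inj₁ (i , s′) , e , e′)

-- Greedy extension of independent sets

module _ (G : Graph) where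

  module _ (Inv : Subset (order G) → Set) {A : Subset (order G) → Vertex G → Set} (A? : ∀ I v → Dec (A I v))
    (fresh : ∀ {I v} → A I v → v ∉ I) (insert : ∀ {I v} → Inv I → A I v → Inv (I ∪ ⁅ v ⁆)) where

    -- `A I v` says that v may still be added to I. Each addition enlarges I, so the fuel `k` in
    -- `go`, which covers the vertices still outside I, cannot run out early.
    greedy : ∀ I → Inv I → ∃ λ J → Inv J × (∀ v → ¬ A J v)
    greedy I inv = go (order G) I inv (m≤n+m _ _)
      where
      go : ∀ k I → Inv I → order G ≤ ∣ I ∣ + k → ∃ λ J → Inv J × (∀ v → ¬ A J v)
      go k I inv bound with any? (A? I)
      ... | no none = I , inv , λ v a → none (v , a)
      ... | yes (v , a) = larger k bound
        where
        I<J : ∣ I ∣ < ∣ I ∪ ⁅ v ⁆ ∣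
        I<J = p⊂q⇒∣p∣<∣q∣ (p⊆p∪q ⁅ v ⁆ , v , q⊆p∪q I ⁅ v ⁆ (x∈⁅x⁆ v) , fresh a)
        larger : ∀ k → order G ≤ ∣ I ∣ + k → ∃ λ J → Inv J × (∀ v → ¬ A J v)
        larger zero bound = contradiction (<-≤-trans I<J (≤-trans (∣p∣≤n (I ∪ ⁅ v ⁆)) bound)) (<-irrefl (sym (+-identityʳ _)))
        larger (suc k) bound = go k (I ∪ ⁅ v ⁆) (insert inv a) (≤-trans bound (≤-trans (≤-reflexive (+-suc _ k)) (+-monoˡ-≤ k I<J)))

  independent-insert : ∀ {I v} → Independent G (_∈ I) → Residual G (_∈ I) v → Independent G (_∈ I ∪ ⁅ v ⁆)
  independent-insert {I} {v} ind (_ , none) x∈ y∈ e with x∈p∪q⁻ I ⁅ v ⁆ x∈ | x∈p∪q⁻ I ⁅ v ⁆ y∈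
  ... | inj₁ x∈I | inj₁ y∈I = ind x∈I y∈I e
  ... | inj₁ x∈I | inj₂ y∈v rewrite x∈⁅y⁆⇒x≡y v y∈v = none _ x∈I e
  ... | inj₂ x∈v | inj₁ y∈I rewrite x∈⁅y⁆⇒x≡y v x∈v = none _ y∈I (E-sym G e)
  ... | inj₂ x∈v | inj₂ y∈v rewrite x∈⁅y⁆⇒x≡y v x∈v | x∈⁅y⁆⇒x≡y v y∈v = E-irrefl G e

  MaximalIndependent : (Vertex G → Set) → Set
  MaximalIndependent J = Independent G J × (∀ v → ¬ Residual G J v)

  extend-pair : ∀ {u w} → ¬ E G u w → ∃ λ J → MaximalIndependent (_∈ J) × u ∈ J × w ∈ J
  extend-pair {u} {w} ¬e =
    let J , (ind , u∈ , w∈) , max = greedy (λ J → Independent G (_∈ J) × u ∈ J × w ∈ J) (λ I → residual? G (_∈? I)) proj₁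
          (λ (ind , u∈ , w∈) r → independent-insert ind r , p⊆p∪q _ u∈ , p⊆p∪q _ w∈)
          (⁅ u ⁆ ∪ ⁅ w ⁆) (ind₀ , p⊆p∪q _ (x∈⁅x⁆ u) , q⊆p∪q ⁅ u ⁆ _ (x∈⁅x⁆ w))
    in J , (ind , max) , u∈ , w∈
    where
    ind₀ : Independent G (_∈ ⁅ u ⁆ ∪ ⁅ w ⁆)
    ind₀ x∈ y∈ e with x∈p∪q⁻ ⁅ u ⁆ ⁅ w ⁆ x∈ | x∈p∪q⁻ ⁅ u ⁆ ⁅ w ⁆ y∈
    ... | inj₁ p | inj₁ q rewrite x∈⁅y⁆⇒x≡y u p | x∈⁅y⁆⇒x≡y u q = E-irrefl G e
    ... | inj₁ p | inj₂ q rewrite x∈⁅y⁆⇒x≡y u p | x∈⁅y⁆⇒x≡y w q = ¬e e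
    ... | inj₂ p | inj₁ q rewrite x∈⁅y⁆⇒x≡y w p | x∈⁅y⁆⇒x≡y u q = ¬e (E-sym G e)
    ... | inj₂ p | inj₂ q rewrite x∈⁅y⁆⇒x≡y w p | x∈⁅y⁆⇒x≡y w q = E-irrefl G e

  -- Non-adjacency, already reflexive and symmetric, is transitive on R. Its classes are the parts
  -- of a complete multipartite graph.
  Multipartite : (Vertex G → Set) → Set
  Multipartite R = ∀ {v x y} → R v → R x → R y → ¬ E G v x → ¬ E G v y → ¬ E G x y

  -- Choose I maximal among the independent sets whose residual graph has an edge.
  multipartite-residual : ∀ {a b} → E G a b → ∃ λ I → Independent G (_∈ I) ×
    (∃₂ λ a b → Residual G (_∈ I) a × Residual G (_∈ I) b × E G a b) × Multipartite (Residual G (_∈ I))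
  multipartite-residual {a} {b} e =
    let I , (ind , edge) , max = greedy (λ I → Independent G (_∈ I) × Edge (Residual G (_∈ I))) Addable? fresh insert
          ∅ ((λ x∈ → contradiction x∈ ∉⊥) , a , b , (∉⊥ , λ u u∈ → contradiction u∈ ∉⊥) , (∉⊥ , λ u u∈ → contradiction u∈ ∉⊥) , e)
    -- An edge xy avoiding the neighbours of v would survive in the residual graph after adding v,
    -- so v would still be addable.
    in I , ind , edge , λ rv rx ry ¬vx ¬vy xy → max _ (rv , _ , _ , (rx , ¬vx) , (ry , ¬vy) , xy)
    where
    Edge : (Vertex G → Set) → Set
    Edge R = ∃₂ λ a b → R a × R b × E G a b
    Addable : Subset (order G) → Vertex G → Set
    Addable I v = Residual G (_∈ I) v × Edge (λ x → Residual G (_∈ I) x × ¬ E G v x)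
    Addable? : ∀ I v → Dec (Addable I v)
    Addable? I v = residual? G (_∈? I) v ×-dec any? (λ x → any? (λ y →
      (residual? G (_∈? I) x ×-dec ¬? (E? G v x)) ×-dec (residual? G (_∈? I) y ×-dec ¬? (E? G v y)) ×-dec E? G x y))
    fresh : ∀ {I v} → Addable I v → v ∉ I
    fresh ((v∉ , _) , _) = v∉
    residual-insert : ∀ {I v x} → v ≢ x → Residual G (_∈ I) x → ¬ E G v x → Residual G (_∈ I ∪ ⁅ v ⁆) x
    residual-insert {I} {v} {x} v≢x (x∉ , none) ¬vx =
      (λ x∈ → [ x∉ , (λ q → v≢x (sym (x∈⁅y⁆⇒x≡y v q))) ]′ (x∈p∪q⁻ I ⁅ v ⁆ x∈)) ,
      (λ u u∈ e → [ (λ p → none u p e) , (λ q → ¬vx (subst (λ t → E G t x) (x∈⁅y⁆⇒x≡y v q) e)) ]′ (x∈p∪q⁻ I ⁅ v ⁆ u∈))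
    insert : ∀ {I v} → Independent G (_∈ I) × Edge (Residual G (_∈ I)) → Addable I v →
      Independent G (_∈ I ∪ ⁅ v ⁆) × Edge (Residual G (_∈ I ∪ ⁅ v ⁆))
    insert (ind , _) (r , x , y , (rx , ¬vx) , (ry , ¬vy) , xy) = independent-insert ind r , x , y ,
      -- Neither endpoint of xy equals v, because v is adjacent to neither while x and y are
      -- adjacent.
      residual-insert (λ { refl → ¬vy xy }) rx ¬vx , residual-insert (λ { refl → ¬vx (E-sym G xy) }) ry ¬vy , xy

-- Multipartite residual graphs

module _ {n} {P : Fin n → Set} (P? : ∀ i → Dec (P i)) where

  -- A further element of P, put in front of `xs`, would give a repetition-free list longer than the
  -- count allows.
  #-exhausted : ∀ {xs} → Unique xs → All P xs → # P? ≤ length xs → ∀ {i} → P i → i ∈ˡ xs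
  #-exhausted {xs} uxs pxs bound {i} p with _∈ˡ?_ _≟_ i xs
  ... | yes i∈ = i∈
  ... | no i∉ = contradiction (≤-trans (#-≥-list P? (¬Any⇒All¬ xs i∉ ∷ uxs) (p ∷ pxs)) bound) 1+n≰n

∈-pair? : ∀ {n} (a b : Fin n) → ∀ i → Dec (i ∈ˡ a ∷ b ∷ [])
∈-pair? a b i = _∈ˡ?_ _≟_ i (a ∷ b ∷ [])

#-pair : ∀ {n} (a b : Fin n) → # (∈-pair? a b) ≤ 2
#-pair a b = #-≤-list _ (a ∷ b ∷ []) (λ x → x)

record Triangle (G : Graph) (R : Vertex G → Set) : Set where
  constructor triangle
  field
    {a b c} : Vertex G
    ab : E G a b
    bc : E G b c
    ca : E G c a
    a∈ : R a
    b∈ : R b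
    c∈ : R c
    all : ∀ {g} → R g → g ∈ˡ a ∷ b ∷ c ∷ []

Clique : (G : Graph) → (Vertex G → Set) → Set
Clique G R = ∀ {x y} → R x → R y → x ≢ y → E G x y

module _ (G : Graph) {R : Vertex G → Set} (R? : ∀ g → Dec (R g)) where

  clique? : Clique G R ⊎ ∃₂ λ x y → R x × R y × x ≢ y × ¬ E G x y
  clique? with any? (λ x → any? (λ y → R? x ×-dec R? y ×-dec ¬? (x ≟ y) ×-dec ¬? (E? G x y)))
  ... | yes p = inj₂ p
  ... | no none = inj₁ (λ {x} {y} rx ry ne → decidable-stable (E? G x y) (λ ¬e → none (x , y , rx , ry , ne , ¬e)))

module _ (G : Graph) {R : Vertex G → Set} (multi : Multipartite G R) {a b : Vertex G} (ra : R a) (rb : R b) (ab : E G a b) where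

  -- A vertex adjacent to neither a nor b would put both into its own part, although ab is an edge.
  -- Thus {a , b} dominates all of R totally, including a and b themselves.
  edge-dominates : ∀ {g} → R g → E G a g ⊎ E G b g
  edge-dominates {g} r with E? G a g | E? G b g
  ... | yes e | _ = inj₁ e
  ... | no _ | yes e = inj₂ e
  ... | no ¬e | no ¬e′ = contradiction ab (multi r ra rb (¬e ∘ E-sym G) (¬e′ ∘ E-sym G))

  multipartite-noIsolated : NoIsolated G R
  multipartite-noIsolated r = [ (λ e → a , ra , e) , (λ e → b , rb , e) ]′ (edge-dominates r)

module _ (G H : Graph) {R : Vertex G → Set} {S : Vertex H → Set} (R? : ∀ g → Dec (R g)) (S? : ∀ h → Dec (S h))
  (tight : Tight G H R S) (multi : Multipartite G R) (isoS : NoIsolated H S) where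

  -- The non-neighbours of a in R form the part of a. This part times S is a maximal independent set
  -- of R × S, so tightness bounds every dominating set from below.
  part-bound : ∀ {D} (D? : ∀ g h → Dec (D g h)) → (∀ {g h} → R g → S h → Dominates₂ G H D g h) →
    ∀ {a} → R a → # (λ g → R? g ×-dec ¬? (E? G a g)) * # S? ≤ ## D?
  part-bound D? domD {a} ra = ≤-trans (≤-reflexive (sym (##-⊠ P? S?)))
    (tight (P? ⊠? S?) D? (λ ((r , _) , s) → r , s) (λ ((r , ¬e) , _) ((r′ , ¬e′) , _) e _ → multi ra r r′ ¬e ¬e′ e) domM domD)
    where
    P? = λ g → R? g ×-dec ¬? (E? G a g)
    domM : ∀ {g h} → R g → S h → Dominates₂ G H (λ g h → (R g × ¬ E G a g) × S h) g h
    domM {g} {h} r s with E? G a g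
    ... | no ¬e = inj₁ ((r , ¬e) , s)
    ... | yes e = let h′ , s′ , e′ = isoS s in inj₂ (a , h′ , ((ra , E-irrefl G) , s′) , e , e′)

  module _ {a₀ a₁ : Vertex G} {b₀ b₁ : Vertex H} (ra₀ : R a₀) (ra₁ : R a₁) (ea : E G a₀ a₁)
    (multi′ : Multipartite H S) (sb₀ : S b₀) (sb₁ : S b₁) (eb : E H b₀ b₁) where

    -- The part of x has at least two vertices, while the four vertices of {a₀ , a₁} × {b₀ , b₁}
    -- dominate. Hence 2|S| ≤ 4.
    nonadjacent⇒pair : (∃₂ λ x y → R x × R y × x ≢ y × ¬ E G x y) → ∀ {h} → S h → h ∈ˡ b₀ ∷ b₁ ∷ []
    nonadjacent⇒pair (x , y , rx , ry , x≢y , ¬e) =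
      #-exhausted S? ((E⇒≢ H eb ∷ []) ∷ [] ∷ []) (sb₀ ∷ sb₁ ∷ []) (*-cancelˡ-≤ 2 (begin
        2 * # S?                                   ≤⟨ *-monoˡ-≤ (# S?) (#-≥-list (λ g → R? g ×-dec ¬? (E? G x g)) ((x≢y ∷ []) ∷ [] ∷ []) ((rx , E-irrefl G) ∷ (ry , ¬e) ∷ [])) ⟩
        # (λ g → R? g ×-dec ¬? (E? G x g)) * # S?  ≤⟨ part-bound (∈-pair? a₀ a₁ ⊠? ∈-pair? b₀ b₁) dom rx ⟩
        ## (∈-pair? a₀ a₁ ⊠? ∈-pair? b₀ b₁)        ≡⟨ ##-⊠ (∈-pair? a₀ a₁) (∈-pair? b₀ b₁) ⟩
        # (∈-pair? a₀ a₁) * # (∈-pair? b₀ b₁)      ≤⟨ *-mono-≤ (#-pair a₀ a₁) (#-pair b₀ b₁) ⟩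
        4                                          ∎))
      where
      open ≤-Reasoning
      pick : ∀ {X : Graph} {a b g} → E X a g ⊎ E X b g → ∃ λ g′ → g′ ∈ˡ a ∷ b ∷ [] × E X g′ g
      pick (inj₁ e) = _ , here refl , e
      pick (inj₂ e) = _ , there (here refl) , e
      dom : ∀ {g h} → R g → S h → Dominates₂ G H (λ g h → g ∈ˡ a₀ ∷ a₁ ∷ [] × h ∈ˡ b₀ ∷ b₁ ∷ []) g h
      dom r s = let g′ , g∈ , e = pick {G} (edge-dominates G multi ra₀ ra₁ ea r)
                    h′ , h∈ , e′ = pick {H} (edge-dominates H multi′ sb₀ sb₁ eb s)
                in inj₂ (g′ , h′ , (g∈ , h∈) , e , e′)

    -- The diagonal of two triangles is a total dominating set of the product of two cliques.
    cliques⇒triangle : Clique G R → Clique H S → (∃ λ a₂ → R a₂ × ¬ (a₂ ∈ˡ a₀ ∷ a₁ ∷ [])) → (∃ λ b₂ → S b₂ × ¬ (b₂ ∈ˡ b₀ ∷ b₁ ∷ [])) → Triangle H S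
    cliques⇒triangle kR kS (a₂ , ra₂ , a₂∉) (b₂ , sb₂ , b₂∉) =
      triangle eb (kS sb₁ sb₂ b₁≢b₂) (kS sb₂ sb₀ (b₀≢b₂ ∘ sym)) sb₀ sb₁ sb₂
        (#-exhausted S? ((E⇒≢ H eb ∷ b₀≢b₂ ∷ []) ∷ (b₁≢b₂ ∷ []) ∷ [] ∷ []) (sb₀ ∷ sb₁ ∷ sb₂ ∷ [])
          (begin
            # S?                                           ≡⟨ +-identityʳ (# S?) ⟨
            1 * # S?                                       ≤⟨ *-monoˡ-≤ (# S?) (#-≥1 (λ g → R? g ×-dec ¬? (E? G a₀ g)) (ra₀ , E-irrefl G)) ⟩
            # (λ g → R? g ×-dec ¬? (E? G a₀ g)) * # S?     ≤⟨ part-bound D? dom ra₀ ⟩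
            ## D?                                          ≤⟨ ##-cover (point? a₀ b₀) D′? D? (λ x → x) ⟩
            ## (point? a₀ b₀) + ## D′?                     ≤⟨ +-mono-≤ (##-point a₀ b₀) (##-cover (point? a₁ b₁) (point? a₂ b₂) D′? (λ x → x)) ⟩
            1 + (## (point? a₁ b₁) + ## (point? a₂ b₂))    ≤⟨ +-monoʳ-≤ 1 (+-mono-≤ (##-point a₁ b₁) (##-point a₂ b₂)) ⟩
            3                                              ∎))
      where
      open ≤-Reasoning
      b₀≢b₂ : b₀ ≢ b₂
      b₀≢b₂ refl = b₂∉ (here refl)
      b₁≢b₂ : b₁ ≢ b₂
      b₁≢b₂ refl = b₂∉ (there (here refl))
      a₀≢a₂ : a₀ ≢ a₂
      a₀≢a₂ refl = a₂∉ (here refl)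
      a₁≢a₂ : a₁ ≢ a₂
      a₁≢a₂ refl = a₂∉ (there (here refl))
      point? : (a : Vertex G) (b : Vertex H) → ∀ g h → Dec (g ≡ a × h ≡ b)
      point? a b = (_≟ a) ⊠? (_≟ b)
      ##-point : ∀ a b → ## (point? a b) ≤ 1
      ##-point a b = ≤-trans (≤-reflexive (##-⊠ (_≟ a) (_≟ b))) (*-mono-≤ (#-≡ a) (#-≡ b))
      D′? : ∀ g h → Dec (g ≡ a₁ × h ≡ b₁ ⊎ g ≡ a₂ × h ≡ b₂)
      D′? g h = point? a₁ b₁ g h ⊎-dec point? a₂ b₂ g h
      D? = λ g h → point? a₀ b₀ g h ⊎-dec D′? g h
      D : Vertex G → Vertex H → Set
      D g h = g ≡ a₀ × h ≡ b₀ ⊎ g ≡ a₁ × h ≡ b₁ ⊎ g ≡ a₂ × h ≡ b₂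
      dom : ∀ {g h} → R g → S h → Dominates₂ G H D g h
      -- A diagonal vertex fails to be adjacent to (g , h) only if it agrees with it in some
      -- coordinate. If all three failed, two of them would share a coordinate, but the diagonal has
      -- no repeated coordinate.
      dom {g} {h} r s with a₀ ≟ g | b₀ ≟ h | a₁ ≟ g | b₁ ≟ h | a₂ ≟ g | b₂ ≟ h
      ... | no p | no q | _ | _ | _ | _ = inj₂ (a₀ , b₀ , inj₁ (refl , refl) , kR ra₀ r p , kS sb₀ s q)
      ... | yes p | _ | yes p′ | _ | _ | _ = contradiction (trans p (sym p′)) (E⇒≢ G ea)
      ... | yes p | _ | _ | _ | yes p′ | _ = contradiction (trans p (sym p′)) a₀≢a₂
      ... | _ | yes p | _ | yes p′ | _ | _ = contradiction (trans p (sym p′)) (E⇒≢ H eb)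
      ... | _ | yes p | _ | _ | _ | yes p′ = contradiction (trans p (sym p′)) b₀≢b₂
      ... | _ | _ | no p | no q | _ | _ = inj₂ (a₁ , b₁ , inj₂ (inj₁ (refl , refl)) , kR ra₁ r p , kS sb₁ s q)
      ... | _ | _ | _ | _ | no p | no q = inj₂ (a₂ , b₂ , inj₂ (inj₂ (refl , refl)) , kR ra₂ r p , kS sb₂ s q)
      ... | _ | _ | yes p | _ | yes p′ | _ = contradiction (trans p (sym p′)) a₁≢a₂
      ... | _ | _ | _ | yes p | _ | yes p′ = contradiction (trans p (sym p′)) b₁≢b₂

Pair : (G : Graph) → (Vertex G → Set) → Set
Pair G R = ∃₂ λ a b → R a × R b × E G a b × (∀ {g} → R g → g ∈ˡ a ∷ b ∷ [])

edge-or-third : (G : Graph) {R : Vertex G → Set} (R? : ∀ g → Dec (R g)) → ∀ a b → (∀ g → R g → g ∈ˡ a ∷ b ∷ []) ⊎ ∃ λ c → R c × ¬ (c ∈ˡ a ∷ b ∷ [])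
edge-or-third G R? a b with any? (λ c → R? c ×-dec ¬? (∈-pair? a b c))
... | yes p = inj₂ p
... | no none = inj₁ (λ g r → decidable-stable (∈-pair? a b g) (λ g∉ → none (g , r , g∉)))

-- A non-clique on one side forces a single edge on the other. Two cliques that both have a third
-- vertex are triangles, by the diagonal.
tight-multipartite : (G H : Graph) {R : Vertex G → Set} {S : Vertex H → Set} (R? : ∀ g → Dec (R g)) (S? : ∀ h → Dec (S h)) →
  Tight G H R S → Multipartite G R → Multipartite H S →
  (∃₂ λ a b → R a × R b × E G a b) → (∃₂ λ a b → S a × S b × E H a b) →
  Pair G R ⊎ Pair H S ⊎ (Triangle G R × Triangle H S)
tight-multipartite G H {R} {S} R? S? tight multi multi′ (a , b , ra , rb , ab) (c , d , sc , sd , cd) = result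
  where
  isoR = multipartite-noIsolated G multi ra rb ab
  isoS = multipartite-noIsolated H multi′ sc sd cd
  tight′ = tight-swap G H tight
  result : Pair G R ⊎ Pair H S ⊎ (Triangle G R × Triangle H S)
  result with clique? G R? | clique? H S? | edge-or-third G R? a b | edge-or-third H S? c d
  ... | inj₂ non | _ | _ | _ = inj₂ (inj₁ (c , d , sc , sd , cd , nonadjacent⇒pair G H R? S? tight multi isoS ra rb ab multi′ sc sd cd non))
  ... | _ | inj₂ non | _ | _ = inj₁ (a , b , ra , rb , ab , nonadjacent⇒pair H G S? R? tight′ multi′ isoR sc sd cd multi ra rb ab non)
  ... | _ | _ | inj₁ all | _ = inj₁ (a , b , ra , rb , ab , all _)
  ... | _ | _ | _ | inj₁ all = inj₂ (inj₁ (c , d , sc , sd , cd , all _))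
  ... | inj₁ kR | inj₁ kS | inj₂ third | inj₂ third′ = inj₂ (inj₂
        ( cliques⇒triangle H G S? R? tight′ multi′ isoR sc sd cd multi ra rb ab kS kR third′ third
        , cliques⇒triangle G H R? S? tight multi isoS ra rb ab multi′ sc sd cd kR kS third third′))

-- Products with a triangle

module TriangleFactor (G H : Graph) {R : Vertex G → Set} (R? : ∀ g → Dec (R g)) (tri : Triangle G R)
  (tight : Tight G H R U) (isoH : NoIsolated H U) where

  open Triangle tri

  #R≤3 : # R? ≤ 3
  #R≤3 = #-≤-list R? (a ∷ b ∷ c ∷ []) all

  3≤#R : 3 ≤ # R?
  3≤#R = #-≥-list R? ((E⇒≢ G ab ∷ (E⇒≢ G ca ∘ sym) ∷ []) ∷ (E⇒≢ G bc ∷ []) ∷ [] ∷ []) (a∈ ∷ b∈ ∷ c∈ ∷ [])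

  neighbour : ∀ {g} → R g → ∃ λ g′ → R g′ × E G g′ g
  neighbour r with all r
  ... | here refl = c , c∈ , ca
  ... | there (here refl) = a , a∈ , ab
  ... | there (there (here refl)) = b , b∈ , bc

  a-dominates : ∀ {g} → R g → g ≡ a ⊎ E G a g
  a-dominates r with all r
  ... | here refl = inj₁ refl
  ... | there (here refl) = inj₂ ab
  ... | there (there (here refl)) = inj₂ (E-sym G ca)

  ab-dominates : ∀ {g} → R g → E G a g ⊎ E G b g
  ab-dominates r with all r
  ... | here refl = inj₂ (E-sym G ab)
  ... | there (here refl) = inj₁ ab
  ... | there (there (here refl)) = inj₂ bc

  module _ {J : Vertex H → Set} (J? : ∀ h → Dec (J h)) (maxJ : MaximalIndependent H J) where

    dom-R⊠J : ∀ {g h} → R g → U h → Dominates₂ G H (λ g h → R g × J h) g h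
    dom-R⊠J r _ with ¬residual H J? (proj₂ maxJ _)
    ... | inj₁ j = inj₁ (r , j)
    ... | inj₂ (u , j , e) = let g′ , r′ , e′ = neighbour r in inj₂ (g′ , u , (r′ , j) , e′ , e)

    -- R × J is a maximal independent set, since J is one and the triangle has no isolated vertex.
    -- It has at least 3|J| vertices.
    dominating-≥ : ∀ {D} (D? : ∀ g h → Dec (D g h)) → (∀ {g h} → R g → U h → Dominates₂ G H D g h) → 3 * # J? ≤ ## D?
    dominating-≥ D? domD = ≤-trans (*-monoˡ-≤ (# J?) 3≤#R) (≤-trans (≤-reflexive (sym (##-⊠ R? J?)))
      (tight (R? ⊠? J?) D? (λ (r , _) → r , tt) (λ (_ , j) (_ , j′) _ e → proj₁ maxJ j j′ e) dom-R⊠J domD))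

    dom-layer : ∀ {g h} → R g → U h → Dominates₂ G H (λ g h → g ≡ a × U h) g h
    dom-layer r _ with a-dominates r
    ... | inj₁ refl = inj₁ (refl , tt)
    ... | inj₂ e = let h′ , _ , e′ = isoH tt in inj₂ (a , h′ , (refl , tt) , e , e′)

    -- The layer {a} × V(H) and the set R × J are both independent and dominating, so tightness
    -- compares them in either direction. This direction uses the layer as the independent set.
    order≤ : order H ≤ 3 * # J?
    order≤ = begin
      order H                    ≡⟨ #U ⟨
      # (U? (order H))           ≡⟨ +-identityʳ _ ⟨
      1 * # (U? (order H))       ≤⟨ *-monoˡ-≤ _ (#-≥1 (_≟ a) refl) ⟩
      # (_≟ a) * # (U? (order H))            ≡⟨ ##-⊠ (_≟ a) (U? (order H)) ⟨
      ## ((_≟ a) ⊠? (U? (order H)))          ≤⟨ tight ((_≟ a) ⊠? (U? (order H))) (R? ⊠? J?) (λ { (refl , _) → a∈ , tt })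
                                      (λ { (refl , _) (refl , _) e _ → E-irrefl G e }) dom-layer dom-R⊠J ⟩
      ## (R? ⊠? J?)              ≡⟨ ##-⊠ R? J? ⟩
      # R? * # J?                ≤⟨ *-monoˡ-≤ _ #R≤3 ⟩
      3 * # J?                   ∎
      where open ≤-Reasoning

    order≥ : 3 * # J? ≤ order H
    order≥ = begin
      3 * # J?                   ≤⟨ dominating-≥ ((_≟ a) ⊠? (U? (order H))) dom-layer ⟩
      ## ((_≟ a) ⊠? (U? (order H)))          ≡⟨ ##-⊠ (_≟ a) (U? (order H)) ⟩
      # (_≟ a) * # (U? (order H))            ≤⟨ *-monoˡ-≤ _ (#-≡ a) ⟩
      1 * # (U? (order H))       ≡⟨ +-identityʳ _ ⟩
      # (U? (order H))           ≡⟨ #U ⟩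
      order H                    ∎
      where open ≤-Reasoning

    -- Private neighbours of x with respect to J.
    Private : Vertex H → Vertex H → Set
    Private x v = E H x v × (∀ z → J z → E H z v → z ≡ x)

    private? : ∀ x v → Dec (Private x v)
    private? x v = E? H x v ×-dec all? (λ z → J? z →-dec (E? H z v →-dec (z ≟ x)))

    other-or-only : ∀ x v → (∃ λ z → J z × E H z v × z ≢ x) ⊎ (∀ z → J z → E H z v → z ≡ x)
    other-or-only x v with any? (λ z → J? z ×-dec E? H z v ×-dec ¬? (z ≟ x))
    ... | yes p = inj₁ p
    ... | no none = inj₂ (λ z j e → decidable-stable (z ≟ x) (λ ne → none (z , j , e , ne)))

    -- Let K be the set of neighbours of y in J.  If there were no such v, then
    -- R × (J ∖ K) ∪ {b} × (K ∪ {y}) ∪ {a} × ((K ∖ {x}) ∪ {y}) would be a dominating set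
    -- of size at most 3|J| + 1 - |K| < 3|J|.
    shared⇒private : ∀ {x x′ y} → J x → J x′ → x′ ≢ x → E H x y → E H x′ y → ∃ λ v → Private x v
    shared⇒private {x} {x′} {y} jx jx′ x′≢x xy x′y with any? (private? x)
    ... | yes p = p
    -- With k = |K| and l = |J ∖ K|, the bound reads 3(l + k) ≤ 3l + (k + 1) + k. This forces k ≤ 1,
    -- although K contains x and x′.
    ... | no none = contradiction (≤-trans 2≤k (+-cancelˡ-≤ (3 * l + 2 * k) _ _ (begin
          3 * l + 2 * k + k                ≡⟨ solve 2 (λ l k → con 3 :* l :+ con 2 :* k :+ k := con 3 :* (l :+ k)) refl l k ⟩
          3 * (l + k)                      ≤⟨ *-monoʳ-≤ 3 (#-disjoint L? K? J? proj₁ proj₁ (λ (_ , ¬e) (_ , e) → ¬e e)) ⟩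
          3 * # J?                         ≤⟨ dominating-≥ D? dom ⟩
          ## D?                            ≤⟨ ##-cover D₁? D₂₃? D? (λ x → x) ⟩
          ## D₁? + ## D₂₃?                 ≤⟨ +-mono-≤ D₁≤ (≤-trans (##-cover D₂? D₃? D₂₃? (λ x → x)) (+-mono-≤ D₂≤ D₃≤)) ⟩
          3 * l + (suc k + k)              ≡⟨ solve 2 (λ l k → con 3 :* l :+ (con 1 :+ k :+ k) := con 3 :* l :+ con 2 :* k :+ con 1) refl l k ⟩
          3 * l + 2 * k + 1                ∎))) 1+n≰n
      where
      open ≤-Reasoning
      open +-*-Solver
      L? = λ h → J? h ×-dec ¬? (E? H y h)
      K? = λ h → J? h ×-dec E? H y h
      l = # L?
      k = # K?
      2≤k : 2 ≤ k
      2≤k = #-≥-list K? (((x′≢x ∘ sym) ∷ []) ∷ [] ∷ []) ((jx , E-sym H xy) ∷ (jx′ , E-sym H x′y) ∷ [])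
      Ky? = λ h → K? h ⊎-dec (h ≟ y)
      K′? = λ h → K? h ×-dec ¬? (h ≟ x)
      K′y? = λ h → K′? h ⊎-dec (h ≟ y)
      D₁? = R? ⊠? L?
      D₂? = (_≟ b) ⊠? Ky?
      D₃? = (_≟ a) ⊠? K′y?
      D₂₃? = λ g h → D₂? g h ⊎-dec D₃? g h
      D? = λ g h → D₁? g h ⊎-dec D₂₃? g h
      D : Vertex G → Vertex H → Set
      D g h = (R g × J h × ¬ E H y h) ⊎ (g ≡ b × ((J h × E H y h) ⊎ h ≡ y)) ⊎ (g ≡ a × (((J h × E H y h) × h ≢ x) ⊎ h ≡ y))
      D₁≤ : ## D₁? ≤ 3 * l
      D₁≤ = ≤-trans (≤-reflexive (##-⊠ R? L?)) (*-monoˡ-≤ l #R≤3)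
      D₂≤ : ## D₂? ≤ suc k
      D₂≤ = begin
        ## D₂?               ≡⟨ ##-⊠ (_≟ b) Ky? ⟩
        # (_≟ b) * # Ky?     ≤⟨ *-mono-≤ (#-≡ b) (#-cover K? (_≟ y) Ky? (λ x → x)) ⟩
        1 * (k + # (_≟ y))   ≡⟨ *-identityˡ _ ⟩
        k + # (_≟ y)         ≤⟨ +-monoʳ-≤ k (#-≡ y) ⟩
        k + 1                ≡⟨ +-comm k 1 ⟩
        suc k                ∎
      -- In this layer y takes the place of the deleted x.
      D₃≤ : ## D₃? ≤ k
      D₃≤ = begin
        ## D₃?                   ≡⟨ ##-⊠ (_≟ a) K′y? ⟩
        # (_≟ a) * # K′y?        ≤⟨ *-mono-≤ (#-≡ a) (#-cover K′? (_≟ y) K′y? (λ x → x)) ⟩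
        1 * (# K′? + # (_≟ y))   ≡⟨ *-identityˡ _ ⟩
        # K′? + # (_≟ y)         ≤⟨ +-monoʳ-≤ (# K′?) (≤-trans (#-≡ y) (#-≥1 (_≟ x) refl)) ⟩
        # K′? + # (_≟ x)         ≤⟨ #-disjoint K′? (_≟ x) K? proj₁ (λ { refl → jx , E-sym H xy }) (λ (_ , ne) e → ne e) ⟩
        k                        ∎
      -- A vertex z present in both layers over a and b suffices, because the edge ab dominates the
      -- triangle totally.
      by-pair : ∀ {g h z} → R g → D a z → D b z → E H z h → Dominates₂ G H D g h
      by-pair r da db zh with ab-dominates r
      ... | inj₁ e = inj₂ (a , _ , da , e , zh)
      ... | inj₂ e = inj₂ (b , _ , db , e , zh)
      by-y : ∀ {g h} → R g → E H y h → Dominates₂ G H D g h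
      by-y r = by-pair r (inj₂ (inj₂ (refl , inj₂ refl))) (inj₂ (inj₁ (refl , inj₂ refl)))
      dom : ∀ {g h} → R g → U h → Dominates₂ G H D g h
      dom {g} {h} r _ with E? H y h
      ... | yes yh = by-y r yh
      ... | no ¬yh with other-or-only x h
      ...   | inj₁ (z , j , zh , z≢x) with E? H y z
      ...     | yes yz = by-pair r (inj₂ (inj₂ (refl , inj₁ ((j , yz) , z≢x)))) (inj₂ (inj₁ (refl , inj₁ (j , yz)))) zh
      ...     | no ¬yz = let g′ , r′ , e = neighbour r in inj₂ (g′ , z , inj₁ (r′ , j , ¬yz) , e , zh)
      dom {g} {h} r _ | no ¬yh | inj₂ only with ¬residual H J? (proj₂ maxJ h)
      ...     | inj₁ j = inj₁ (inj₁ (r , j , ¬yh))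
      -- The only neighbour of h in J is x, so h is private to x, and this case was excluded.
      ...     | inj₂ (u , j , uh) = contradiction (h , subst (λ t → E H t h) (only u j uh) uh , only) none

    -- R × (J ∖ {x}) together with {a} × ({x} ∪ the private neighbours of x) dominates. With p
    -- private neighbours its size is at most 3(|J| - 1) + 1 + p, which must reach 3|J|.
    private≥2 : ∀ {x v} → J x → Private x v → 2 ≤ # (private? x)
    private≥2 {x} {v} jx pv@(xv , _) = +-cancelˡ-≤ (3 * l + 1) 2 (# (private? x)) (begin
      3 * l + 1 + 2                          ≡⟨ solve 1 (λ l → con 3 :* l :+ con 1 :+ con 2 := con 3 :* (l :+ con 1)) refl l ⟩
      3 * (l + 1)                            ≤⟨ *-monoʳ-≤ 3 (≤-trans (+-monoʳ-≤ l (#-≥1 (_≟ x) refl))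
                                                  (#-disjoint L? (_≟ x) J? proj₁ (λ { refl → jx }) (λ (_ , ne) e → ne e))) ⟩
      3 * # J?                               ≤⟨ dominating-≥ D? dom ⟩
      ## D?                                  ≤⟨ ##-cover (R? ⊠? L?) ((_≟ a) ⊠? N?) D? (λ x → x) ⟩
      ## (R? ⊠? L?) + ## ((_≟ a) ⊠? N?)      ≡⟨ cong₂ _+_ (##-⊠ R? L?) (##-⊠ (_≟ a) N?) ⟩
      # R? * l + # (_≟ a) * # N?             ≤⟨ +-mono-≤ (*-monoˡ-≤ l #R≤3) (*-monoˡ-≤ _ (#-≡ a)) ⟩
      3 * l + 1 * # N?                       ≡⟨ cong (3 * l +_) (*-identityˡ _) ⟩
      3 * l + # N?                           ≤⟨ +-monoʳ-≤ (3 * l) (≤-trans (#-cover (_≟ x) (private? x) N? (λ x → x)) (+-monoˡ-≤ _ (#-≡ x))) ⟩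
      3 * l + (1 + # (private? x))           ≡⟨ +-assoc (3 * l) 1 _ ⟨
      3 * l + 1 + # (private? x)             ∎)
      where
      open ≤-Reasoning
      open +-*-Solver
      L? = λ h → J? h ×-dec ¬? (h ≟ x)
      l = # L?
      N? = λ h → (h ≟ x) ⊎-dec private? x h
      D? = λ g h → (R? ⊠? L?) g h ⊎-dec ((_≟ a) ⊠? N?) g h
      D : Vertex G → Vertex H → Set
      D g h = (R g × J h × h ≢ x) ⊎ (g ≡ a × (h ≡ x ⊎ Private x h))
      dom : ∀ {g h} → R g → U h → Dominates₂ G H D g h
      dom {g} {h} r _ with h ≟ x | a-dominates r
      ... | yes refl | inj₁ refl = inj₁ (inj₂ (refl , inj₁ refl))
      -- The copies of x outside layer a are dominated through the given private neighbour v.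
      ... | yes refl | inj₂ e = inj₂ (a , v , inj₂ (refl , inj₂ pv) , e , E-sym H xv)
      ... | no h≢x | a-dom with other-or-only x h
      ...   | inj₁ (z , j , zh , z≢x) = let g′ , r′ , e = neighbour r in inj₂ (g′ , z , inj₁ (r′ , j , z≢x) , e , zh)
      ...   | inj₂ only with ¬residual H J? (proj₂ maxJ h)
      ...     | inj₁ j = inj₁ (inj₁ (r , j , h≢x))
      ...     | inj₂ (u , j , uh) with only u j uh | a-dom
      ...       | refl | inj₁ refl = inj₁ (inj₂ (refl , inj₂ (uh , only)))
      ...       | refl | inj₂ e = inj₂ (a , x , inj₂ (refl , inj₁ refl) , e , uh)

    -- Any neighbour of x is private or shared with another vertex of J, and in the latter case
    -- `shared⇒private` still yields a private one. Then there are two, and x itself is the third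
    -- vertex.
    closed-private≥3 : ∀ {x} → J x → 3 ≤ # (λ v → (v ≟ x) ⊎-dec private? x v)
    closed-private≥3 {x} jx = ≤-trans (+-mono-≤ (#-≥1 (_≟ x) refl) (private≥2 jx (proj₂ some)))
      (#-disjoint (_≟ x) (private? x) (λ v → (v ≟ x) ⊎-dec private? x v) inj₁ inj₂ (λ { refl (e , _) → E-irrefl H e }))
      where
      some : ∃ λ v → Private x v
      some with isoH {x} tt
      ... | v , _ , vx with other-or-only x v
      ...   | inj₂ only = v , E-sym H vx , only
      ...   | inj₁ (x′ , j , e , x′≢x) = shared⇒private jx j x′≢x (E-sym H vx) e

    -- The sets consisting of a vertex of J and its private neighbours are disjoint and have at
    -- least three elements each. All of them miss a shared neighbour y, so |V(H)| would exceed
    -- 3|J|.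
    no-shared : ∀ {x x′ y} → J x → J x′ → x ≢ x′ → E H x y → ¬ E H x′ y
    no-shared {x} {x′} {y} jx jx′ x≢x′ xy x′y = 1+n≰n (begin
      suc (3 * # J?)                    ≤⟨ s≤s (#-relation J? (λ v → ¬? (v ≟ y)) (λ x v → (v ≟ x) ⊎-dec private? x v) 3 closed-private≥3 into functional) ⟩
      suc (# (λ v → ¬? (v ≟ y)))        ≤⟨ +-monoˡ-≤ _ (#-≥1 (_≟ y) refl) ⟩
      # (_≟ y) + # (λ v → ¬? (v ≟ y))   ≤⟨ #-disjoint (_≟ y) (λ v → ¬? (v ≟ y)) (U? (order H)) _ _ (λ e ne → ne e) ⟩
      # (U? (order H))                  ≡⟨ #U ⟩
      order H                           ≤⟨ order≤ ⟩
      3 * # J?                          ∎)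
      where
      open ≤-Reasoning
      into : ∀ {i j} → J i → j ≡ i ⊎ Private i j → j ≢ y
      into j (inj₁ refl) refl = proj₁ maxJ jx j xy
      into j (inj₂ (_ , only)) refl = x≢x′ (trans (only x jx xy) (sym (only x′ jx′ x′y)))
      functional : ∀ {i i′ j} → J i → J i′ → j ≡ i ⊎ Private i j → j ≡ i′ ⊎ Private i′ j → i ≡ i′
      functional j j′ (inj₁ refl) (inj₁ refl) = refl
      functional j j′ (inj₁ refl) (inj₂ (e , _)) = contradiction e (proj₁ maxJ j′ j)
      functional j j′ (inj₂ (e , _)) (inj₁ refl) = contradiction e (proj₁ maxJ j j′)
      functional j j′ (inj₂ (e , _)) (inj₂ (_ , only)) = only _ j e

  -- The ends of an induced path uvw would lie in a common maximal independent set with shared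
  -- neighbour v.
  E-trans : ∀ {u v w} → E H u v → E H v w → u ≢ w → E H u w
  E-trans {u} {v} {w} uv vw u≢w = decidable-stable (E? H u w) λ ¬uw →
    let J , maxJ , u∈ , w∈ = extend-pair H ¬uw in no-shared (_∈? J) maxJ u∈ w∈ u≢w uv (E-sym H vw)

  complete : Connected H → Clique H U
  complete conn {u} {v} _ _ u≢v = [ (λ e → contradiction e u≢v) , (λ e → e) ]′ (walk (conn u v))
    where
    walk : ∀ {v} → Reach H u v → u ≡ v ⊎ E H u v
    walk here = inj₁ refl
    walk (step {v} {w} p e) with u ≟ w
    ... | yes eq = inj₁ eq
    ... | no ne = inj₂ ([ (λ { refl → e }) , (λ e′ → E-trans e′ e ne) ]′ (walk p))

  -- In a complete graph a single vertex is a maximal independent set, so |V(H)| = 3|J| with |J| =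
  -- 1.
  order≡3 : Connected H → Vertex H → order H ≡ 3
  order≡3 conn x = ≤-antisym
    (≤-trans (order≤ (_≟ x) max) (*-monoʳ-≤ 3 (#-≡ x)))
    (≤-trans (*-monoʳ-≤ 3 (#-≥1 (_≟ x) refl)) (order≥ (_≟ x) max))
    where
    max : MaximalIndependent H (_≡ x)
    max = (λ { refl refl → E-irrefl H }) , λ v (v≢x , none) → none x refl (complete conn tt tt (v≢x ∘ sym))

-- Products with an edge

≅-sym : ∀ {X Y} → X ≅ Y → Y ≅ X
≅-sym {X} {Y} iso = record
  { to = from ; from = to ; from-to = to-from ; to-from = from-to
  ; preserves = λ u v → trans (sym (preserves (from u) (from v))) (cong₂ (adj Y) (to-from u) (to-from v)) }
  where open _≅_ iso

bijection⇒≅ : ∀ {X Y} (f : Vertex X → Vertex Y) → (∀ {i j} → f i ≡ f j → i ≡ j) → (∀ v → ∃ λ i → f i ≡ v) →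
  (∀ i j → adj Y (f i) (f j) ≡ adj X i j) → X ≅ Y
bijection⇒≅ f inj surj pres = record
  { to = f ; from = λ v → proj₁ (surj v) ; from-to = λ u → inj (proj₂ (surj (f u))) ; to-from = λ v → proj₂ (surj v) ; preserves = pres }

lookup-injective : ∀ {A : Set} {xs : List A} → Unique xs → ∀ {i j} → lookup xs i ≡ lookup xs j → i ≡ j
lookup-injective (_ ∷ _) {zero} {zero} _ = refl
lookup-injective {xs = _ ∷ xs} (x∉ ∷ _) {zero} {suc j} eq = contradiction eq (All.lookup x∉ (∈-lookup {xs = xs} j))
lookup-injective {xs = _ ∷ xs} (x∉ ∷ _) {suc i} {zero} eq = contradiction (sym eq) (All.lookup x∉ (∈-lookup {xs = xs} i))
lookup-injective (_ ∷ uxs) {suc i} {suc j} eq = cong suc (lookup-injective uxs eq)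

module Leaves (H : Graph) where

  LeafAt : Vertex H → Vertex H → Set
  LeafAt s l = E H s l × (∀ u → E H u l → u ≡ s)

  leafAt? : ∀ s l → Dec (LeafAt s l)
  leafAt? s l = E? H s l ×-dec all? (λ u → E? H u l →-dec (u ≟ s))

  Leaf : Vertex H → Set
  Leaf l = ∃ λ s → LeafAt s l

  leaf? : ∀ l → Dec (Leaf l)
  leaf? l = any? (λ s → leafAt? s l)

  other-neighbour : ∀ {u v} → ¬ LeafAt u v → E H u v → ∃ λ w → w ≢ u × E H w v
  other-neighbour {u} {v} ¬leaf uv with any? (λ w → ¬? (w ≟ u) ×-dec E? H w v)
  ... | yes p = p
  ... | no none = contradiction (uv , λ w wv → decidable-stable (w ≟ u) (λ ne → none (w , ne , wv))) ¬leaf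

  -- The last edge of a walk to v from another vertex supplies the neighbour.
  connected⇒noIsolated : Connected H → 2 ≤ order H → NoIsolated H U
  connected⇒noIsolated conn 2≤n {v} _ = last (another 2≤n v)
    where
    another : ∀ {n} → 2 ≤ n → (v : Fin n) → ∃ λ w → w ≢ v
    another (s≤s (s≤s _)) zero = suc zero , λ ()
    another (s≤s (s≤s _)) (suc v) = zero , λ ()
    last : (∃ λ w → w ≢ v) → ∃ λ u → U u × E H u v
    last (w , w≢v) with conn w v
    ... | here = contradiction refl w≢v
    ... | step {u} _ e = u , tt , e

  -- If the support s were a leaf too, no walk from s could leave {s , l}.
  support-not-leaf : Connected H → 3 ≤ order H → ∀ {s l} → LeafAt s l → ¬ Leaf s
  support-not-leaf conn 3≤n {s} {l} (sl , only) (t , ts , only′) = contradiction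
    (≤-trans 3≤n (≤-trans (≤-reflexive (sym #U)) (#-≤-list (U? (order H)) (s ∷ l ∷ []) (λ {v} _ → walk (conn s v))))) 1+n≰n
    where
    walk : ∀ {v} → Reach H s v → v ∈ˡ s ∷ l ∷ []
    walk here = here refl
    walk (step p e) with walk p
    ... | here refl = there (here (trans (only′ _ (E-sym H e)) (sym (only′ l (E-sym H sl)))))
    ... | there (here refl) = here (only _ (E-sym H e))

  -- If a leaf exists, it serves as x: only its support has it as a neighbour, and the support has
  -- another one. Without leaves any x works, since every vertex has a second neighbour.
  total-avoiding : Connected H → 3 ≤ order H → ∃ λ x → ∀ v → ∃ λ u → u ≢ x × E H u v
  total-avoiding conn 3≤n with any? leaf?
  ... | yes (l , s , sl , only) = l , avoid
    where
    avoid : ∀ v → ∃ λ u → u ≢ l × E H u v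
    avoid v with connected⇒noIsolated conn (≤-trans (n≤1+n 2) 3≤n) {v} tt
    ... | u , _ , uv with u ≟ l
    ...   | no u≢l = u , u≢l , uv
    ...   | yes refl with only v (E-sym H uv)
    ...     | refl = other-neighbour (λ ls → support-not-leaf conn 3≤n (sl , only) (l , ls)) uv
  ... | no none = x , avoid
    where
    some : ∀ {n} → 3 ≤ n → Fin n
    some (s≤s _) = zero
    x = some 3≤n
    avoid : ∀ v → ∃ λ u → u ≢ x × E H u v
    avoid v with connected⇒noIsolated conn (≤-trans (n≤1+n 2) 3≤n) {v} tt
    ... | u , _ , uv with u ≟ x
    ...   | no u≢x = u , u≢x , uv
    ...   | yes refl = other-neighbour (λ lf → none (v , x , lf)) uv


-- Compare V(G) × J with the total dominating set (V(G) ∖ {x}) × T.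
total⇒¬tight : (G H : Graph) {T J : Vertex H → Set} (T? : ∀ h → Dec (T h)) (J? : ∀ h → Dec (J h)) →
  (∀ h → ∃ λ t → T t × E H t h) → MaximalIndependent H J → # T? ≤ # J? → 1 ≤ # J? →
  Connected G → 3 ≤ order G → ¬ Tight G H U U
total⇒¬tight G H {T} {J} T? J? total (ind , max) T≤J 1≤J conn 3≤n tight
  with Leaves.total-avoiding G conn 3≤n
... | x , avoid = <⇒≱ 1≤J (+-cancelʳ-≤ (# V? * # J?) (# J?) 0 (begin
    # J? + # V? * # J?         ≤⟨ *-monoˡ-≤ (# J?) (+-monoˡ-≤ (# V?) (#-≥1 (_≟ x) refl)) ⟩
    (# (_≟ x) + # V?) * # J?   ≤⟨ *-monoˡ-≤ (# J?) (#-disjoint (_≟ x) V? (U? (order G)) _ _ (λ e ne → ne e)) ⟩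
    # (U? (order G)) * # J?    ≡⟨ ##-⊠ (U? (order G)) J? ⟨
    ## (U? (order G) ⊠? J?)    ≤⟨ tight (U? (order G) ⊠? J?) (V? ⊠? T?) _ (λ (_ , j) (_ , j′) _ → ind j j′) (λ _ _ → domJ) (λ {g} {h} _ _ → domT g h) ⟩
    ## (V? ⊠? T?)              ≡⟨ ##-⊠ V? T? ⟩
    # V? * # T?                ≤⟨ *-monoʳ-≤ (# V?) T≤J ⟩
    # V? * # J?                ∎))
  where
  open ≤-Reasoning
  V? = λ g → ¬? (g ≟ x)
  domJ : ∀ {g h} → Dominates₂ G H (λ g h → U g × J h) g h
  domJ {g} {h} with ¬residual H J? (max h)
  ... | inj₁ j = inj₁ (tt , j)
  ... | inj₂ (u , j , e) = let g′ , _ , e′ = avoid g in inj₂ (g′ , u , (tt , j) , e′ , e)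
  domT : ∀ g h → Dominates₂ G H (λ g h → g ≢ x × T h) g h
  domT g h = let g′ , g′≢x , e = avoid g ; t , t∈ , e′ = total h in inj₂ (g′ , t , (g′≢x , t∈) , e , e′)

-- {a} × P ∪ {b} × Q dominates {a , b} × V(H), where ab is an edge of the other factor.
LayersDominate : (H : Graph) → (Vertex H → Set) → (Vertex H → Set) → Set
LayersDominate H P Q = (∀ h → P h ⊎ ∃ λ h′ → Q h′ × E H h′ h) × (∀ h → Q h ⊎ ∃ λ h′ → P h′ × E H h′ h)

LayerBound : Graph → Set₁
LayerBound H = {P Q : Vertex H → Set} (P? : ∀ h → Dec (P h)) (Q? : ∀ h → Dec (Q h)) → LayersDominate H P Q → order H ≤ # P? + # Q?

-- The layer {a} × V(H) is a maximal independent set of R × V(H), so the dominating set {a} × P ∪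
-- {b} × Q is at least as large.
pair⇒layerBound : (G H : Graph) {R : Vertex G → Set} → Pair G R → NoIsolated H U → Tight G H R U → LayerBound H
pair⇒layerBound G H {R} (a , b , ra , rb , ab , all) iso tight {P} {Q} P? Q? (domP , domQ) = begin
  order H                                  ≡⟨ #U ⟨
  # (U? (order H))                         ≡⟨ *-identityˡ _ ⟨
  1 * # (U? (order H))                     ≤⟨ *-monoˡ-≤ _ (#-≥1 (_≟ a) refl) ⟩
  # (_≟ a) * # (U? (order H))              ≡⟨ ##-⊠ (_≟ a) (U? (order H)) ⟨
  ## ((_≟ a) ⊠? U? (order H))              ≤⟨ tight ((_≟ a) ⊠? U? (order H)) D? (λ { (refl , _) → ra , tt }) (λ { (refl , _) (refl , _) e _ → E-irrefl G e }) domM domD ⟩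
  ## D?                                    ≤⟨ ##-cover ((_≟ a) ⊠? P?) ((_≟ b) ⊠? Q?) D? (λ x → x) ⟩
  ## ((_≟ a) ⊠? P?) + ## ((_≟ b) ⊠? Q?)    ≡⟨ cong₂ _+_ (##-⊠ (_≟ a) P?) (##-⊠ (_≟ b) Q?) ⟩
  # (_≟ a) * # P? + # (_≟ b) * # Q?        ≤⟨ +-mono-≤ (*-monoˡ-≤ (# P?) (#-≡ a)) (*-monoˡ-≤ (# Q?) (#-≡ b)) ⟩
  1 * # P? + 1 * # Q?                      ≡⟨ cong₂ _+_ (*-identityˡ (# P?)) (*-identityˡ (# Q?)) ⟩
  # P? + # Q?                              ∎
  where
  open ≤-Reasoning
  D? = λ g h → ((_≟ a) ⊠? P?) g h ⊎-dec ((_≟ b) ⊠? Q?) g h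
  domM : ∀ {g h} → R g → U h → Dominates₂ G H (λ g h → g ≡ a × U h) g h
  domM r _ with all r
  ... | here refl = inj₁ (refl , tt)
  ... | there (here refl) = let h′ , _ , e = iso tt in inj₂ (a , h′ , (refl , tt) , ab , e)
  domD : ∀ {g h} → R g → U h → Dominates₂ G H (λ g h → (g ≡ a × P h) ⊎ (g ≡ b × Q h)) g h
  domD {g} {h} r _ with all r
  ... | here refl = [ (λ p → inj₁ (inj₁ (refl , p))) , (λ (h′ , q , e) → inj₂ (b , h′ , inj₂ (refl , q) , E-sym G ab , e)) ]′ (domP h)
  ... | there (here refl) = [ (λ q → inj₁ (inj₂ (refl , q))) , (λ (h′ , p , e) → inj₂ (a , h′ , inj₁ (refl , p) , ab , e)) ]′ (domQ h)

-- Structure of a graph satisfying the layer bound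

module LayerStructure (H : Graph) (conn : Connected H) (3≤n : 3 ≤ order H) (bound : LayerBound H) where

  open Leaves H

  iso : NoIsolated H U
  iso = connected⇒noIsolated conn (≤-trans (n≤1+n 2) 3≤n)

  private
    #-¬ : {P : Vertex H → Set} (P? : ∀ h → Dec (P h)) → # (λ h → ¬? (P? h)) + # P? ≤ order H
    #-¬ P? = ≤-trans (#-disjoint (λ h → ¬? (P? h)) P? (U? (order H)) _ _ (λ ¬p p → ¬p p)) (≤-reflexive #U)

  Nested : Vertex H → Vertex H → Set
  Nested w z = ∀ u → E H u w → E H u z

  nested? : ∀ w z → Dec (Nested w z)
  nested? w z = all? (λ u → E? H u w →-dec E? H u z)

  -- The layers V ∖ N(z) and {w : N(w) ⊆ N(z)} dominate. The vertex z of the second covers N(z), and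
  -- a vertex missing from the second has a neighbour outside N(z).
  degree≤nested : ∀ z → # (E? H z) ≤ # (λ w → nested? w z)
  degree≤nested z = +-cancelˡ-≤ (# (λ h → ¬? (E? H z h))) _ _
    (≤-trans (#-¬ (E? H z)) (bound (λ h → ¬? (E? H z h)) (λ w → nested? w z) (domP , domQ)))
    where
    domP : ∀ h → ¬ E H z h ⊎ ∃ λ h′ → Nested h′ z × E H h′ h
    domP h with E? H z h
    ... | no ¬zh = inj₁ ¬zh
    ... | yes zh = inj₂ (z , (λ _ e → e) , zh)
    domQ : ∀ h → Nested h z ⊎ ∃ λ h′ → ¬ E H z h′ × E H h′ h
    domQ h with any? (λ u → ¬? (E? H z u) ×-dec E? H u h)
    ... | yes p = inj₂ p
    ... | no none = inj₁ (λ u uh → E-sym H (decidable-stable (E? H z u) (λ ¬zu → none (u , ¬zu , uh))))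

  -- Otherwise the layers V ∖ A and N(z) ∖ {y}, where A = {w : N(w) ⊆ N(z)}, are dominating and too small.
  no-leaf⇒nested : ∀ {y z s} → (∀ l → ¬ LeafAt y l) → E H y z → E H y s → Nested s z
  no-leaf⇒nested {y} {z} {s} none yz ys = decidable-stable (nested? s z) λ ¬nested → 1+n≰n (begin
    suc (# N?)                     ≤⟨ +-monoˡ-≤ (# N?) (#-≥1 (_≟ y) refl) ⟩
    # (_≟ y) + # N?                ≤⟨ #-disjoint (_≟ y) N? (E? H z) (λ { refl → E-sym H yz }) proj₁ (λ e (_ , ne) → ne e) ⟩
    # (E? H z)                     ≤⟨ degree≤nested z ⟩
    # A?                           ≤⟨ +-cancelˡ-≤ (# (λ w → ¬? (A? w))) _ _ (≤-trans (#-¬ A?) (bound (λ w → ¬? (A? w)) N? (domP , domQ ¬nested))) ⟩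
    # N?                           ∎)
    where
    open ≤-Reasoning
    A? = λ w → nested? w z
    N? = λ h → E? H z h ×-dec ¬? (h ≟ y)
    domP : ∀ h → ¬ Nested h z ⊎ ∃ λ h′ → (E H z h′ × h′ ≢ y) × E H h′ h
    domP h with nested? h z
    ... | no ¬nested = inj₁ ¬nested
    ... | yes nested with iso {h} tt
    ...   | u , _ , uh with u ≟ y
    ...     | no u≢y = inj₂ (u , (E-sym H (nested u uh) , u≢y) , uh)
    -- As h is not a leaf at y, it has a neighbour besides y, and this lies in N(z) because N(h) ⊆
    -- N(z).
    ...     | yes refl = let w , w≢y , wh = other-neighbour (none h) uh in inj₂ (w , (E-sym H (nested w wh) , w≢y) , wh)
    domQ : ¬ Nested s z → ∀ h → (E H z h × h ≢ y) ⊎ ∃ λ h′ → ¬ Nested h′ z × E H h′ h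
    domQ ¬nested h with h ≟ y
    ... | yes refl = inj₂ (s , ¬nested , E-sym H ys)
    ... | no h≢y with E? H z h
    ...   | yes zh = inj₁ (zh , h≢y)
    -- Any neighbour w of h is adjacent to h, which is outside N(z), so w is not nested in z.
    ...   | no ¬zh = let w , _ , wh = iso {h} tt in inj₂ (w , (λ nested → ¬zh (E-sym H (nested h (E-sym H wh)))) , wh)

  -- If l and l′ differed, V ∖ {l , l′} and {y} would be dominating layers with only |V| - 1
  -- vertices in total.
  leaf-unique : ∀ {y l l′} → LeafAt y l → LeafAt y l′ → l ≡ l′
  leaf-unique {y} {l} {l′} (yl , only) (yl′ , only′) = decidable-stable (l ≟ l′) λ l≢l′ → 1+n≰n (begin
    2                             ≤⟨ #-≥-list (∈-pair? l l′) ((l≢l′ ∷ []) ∷ [] ∷ []) (here refl ∷ there (here refl) ∷ []) ⟩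
    # (∈-pair? l l′)              ≤⟨ +-cancelˡ-≤ (# P?) _ _ (≤-trans (#-¬ (∈-pair? l l′)) (bound P? (_≟ y) (domP , domQ))) ⟩
    # (_≟ y)                      ≤⟨ #-≡ y ⟩
    1                             ∎)
    where
    open ≤-Reasoning
    P? = λ h → ¬? (∈-pair? l l′ h)
    domP : ∀ h → ¬ (h ∈ˡ l ∷ l′ ∷ []) ⊎ ∃ λ h′ → h′ ≡ y × E H h′ h
    domP h with ∈-pair? l l′ h
    ... | no h∉ = inj₁ h∉
    ... | yes (here refl) = inj₂ (y , refl , yl)
    ... | yes (there (here refl)) = inj₂ (y , refl , yl′)
    domQ : ∀ h → h ≡ y ⊎ ∃ λ h′ → ¬ (h′ ∈ˡ l ∷ l′ ∷ []) × E H h′ h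
    domQ h with h ≟ y
    ... | yes eq = inj₁ eq
    ... | no h≢y = let w , _ , wh = iso {h} tt in inj₂ (w , (λ { (here refl) → h≢y (only h (E-sym H wh)) ; (there (here refl)) → h≢y (only′ h (E-sym H wh)) }) , wh)

  -- The second component excludes a larger cofactor. It is proved along with the structure because
  -- T and J are read off from the cycle or the corona.
  Conclusion : Set₁
  Conclusion = (H ≅ C4 ⊎ ∃ λ F → Connected F × H ≅ Corona F) × (∀ G → Connected G → 3 ≤ order G → ¬ Tight G H U U)

  module Cycle {y : Vertex H} (¬leaf : ¬ Leaf y) (no-leaf : ∀ l → ¬ LeafAt y l) where

    private
      -- The neighbour a of y is arbitrary, a′ exists as y is not a leaf, and y′ exists as a is not
      -- a leaf at y.
      cycle : ∃ λ a → ∃ λ a′ → ∃ λ y′ → E H y a × E H y a′ × E H y′ a × a′ ≢ a × y′ ≢ y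
      cycle =
        let a , _ , ay = iso {y} tt
            a′ , a′≢a , a′y = other-neighbour (λ lf → ¬leaf (a , lf)) ay
            y′ , y′≢y , y′a = other-neighbour (no-leaf a) (E-sym H ay)
        in a , a′ , y′ , E-sym H ay , E-sym H a′y , y′a , a′≢a , y′≢y
      a = proj₁ cycle
      a′ = proj₁ (proj₂ cycle)
      y′ = proj₁ (proj₂ (proj₂ cycle))
      ya : E H y a
      ya = let _ , _ , _ , e , _ = cycle in e
      ya′ : E H y a′
      ya′ = let _ , _ , _ , _ , e , _ = cycle in e
      y′a : E H y′ a
      y′a = let _ , _ , _ , _ , _ , e , _ = cycle in e
      a′≢a : a′ ≢ a
      a′≢a = let _ , _ , _ , _ , _ , _ , e , _ = cycle in e
      y′≢y : y′ ≢ y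
      y′≢y = let _ , _ , _ , _ , _ , _ , _ , e = cycle in e

      -- Being available for z and s in both orders, this makes all neighbours of y have the same
      -- neighbourhood.
      nested-y : ∀ {z s} → E H y z → E H y s → Nested s z
      nested-y = no-leaf⇒nested no-leaf
      y′a′ : E H y′ a′
      y′a′ = nested-y ya′ ya y′ y′a
      -- There is no leaf at a either: it would be adjacent to a′ as well, since a and a′ have the
      -- same neighbourhood.
      nested-a : ∀ {z s} → E H a z → E H a s → Nested s z
      nested-a = no-leaf⇒nested (λ l (al , only) → a′≢a (only a′ (E-sym H (nested-y ya′ ya l (E-sym H al)))))
      ¬yy′ : ¬ E H y y′
      ¬yy′ e = E-irrefl H (nested-y ya e a (E-sym H y′a))
      ¬aa′ : ¬ E H a a′
      ¬aa′ e = E-irrefl H (nested-y ya′ ya a′ (E-sym H e))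

      -- A walk from y alternates between N(a) and N(y), because vertices in N(y) have their
      -- neighbours in N(a) and conversely.
      total : ∀ h → E H y h ⊎ E H a h
      total h = walk (conn y h)
        where
        walk : ∀ {v} → Reach H y v → E H y v ⊎ E H a v
        walk here = inj₂ (E-sym H ya)
        walk (step p e) with walk p
        ... | inj₁ yv = inj₂ (E-sym H (nested-y ya yv _ (E-sym H e)))
        ... | inj₂ av = inj₁ (E-sym H (nested-a (E-sym H ya) av _ (E-sym H e)))

      total-pair : ∀ h → ∃ λ h′ → h′ ∈ˡ y ∷ a ∷ [] × E H h′ h
      total-pair h = [ (λ e → y , here refl , e) , (λ e → a , there (here refl) , e) ]′ (total h)

      xs : List (Vertex H)
      xs = y ∷ a ∷ y′ ∷ a′ ∷ []

      uxs : Unique xs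
      uxs = (E⇒≢ H ya ∷ (y′≢y ∘ sym) ∷ E⇒≢ H ya′ ∷ []) ∷ ((E⇒≢ H y′a ∘ sym) ∷ (a′≢a ∘ sym) ∷ []) ∷ (E⇒≢ H y′a′ ∷ []) ∷ [] ∷ []

      -- Using {y , a} in both layers gives |V(H)| ≤ 4, so the four vertices of the cycle are all of
      -- them.
      all : ∀ v → v ∈ˡ xs
      all v = #-exhausted (U? (order H)) uxs (_ ∷ _ ∷ _ ∷ _ ∷ []) (≤-trans (≤-reflexive #U)
        (≤-trans (bound (∈-pair? y a) (∈-pair? y a) ((λ h → inj₂ (total-pair h)) , (λ h → inj₂ (total-pair h)))) (+-mono-≤ (#-pair y a) (#-pair y a)))) tt

      preserves : ∀ i j → adj H (lookup xs i) (lookup xs j) ≡ adj C4 i j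
      preserves zero zero = adj-irrefl H y
      preserves zero (suc zero) = ya
      preserves zero (suc (suc zero)) = ¬-not ¬yy′
      preserves zero (suc (suc (suc zero))) = ya′
      preserves (suc zero) zero = E-sym H ya
      preserves (suc zero) (suc zero) = adj-irrefl H a
      preserves (suc zero) (suc (suc zero)) = E-sym H y′a
      preserves (suc zero) (suc (suc (suc zero))) = ¬-not ¬aa′
      preserves (suc (suc zero)) zero = ¬-not (¬yy′ ∘ E-sym H)
      preserves (suc (suc zero)) (suc zero) = y′a
      preserves (suc (suc zero)) (suc (suc zero)) = adj-irrefl H y′
      preserves (suc (suc zero)) (suc (suc (suc zero))) = y′a′
      preserves (suc (suc (suc zero))) zero = E-sym H ya′
      preserves (suc (suc (suc zero))) (suc zero) = ¬-not (¬aa′ ∘ E-sym H)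
      preserves (suc (suc (suc zero))) (suc (suc zero)) = E-sym H y′a′
      preserves (suc (suc (suc zero))) (suc (suc (suc zero))) = adj-irrefl H a′

      side-independent : MaximalIndependent H (E H a)
      side-independent = (λ {u} {v} au av uv → E-irrefl H (nested-a au av u uv)) ,
        λ v (¬av , none) → [ (λ yv → none y (E-sym H ya) yv) , ¬av ]′ (total v)

    conclusion : Conclusion
    conclusion =
      inj₁ (≅-sym (bijection⇒≅ {C4} (lookup xs) (lookup-injective uxs) (λ v → index (all v) , sym (lookup-index (all v))) preserves)) ,
      -- T = {y , a} and J = N(a), which contains y and y′.
      λ G → total⇒¬tight G H (∈-pair? y a) (E? H a) total-pair side-independent
        (≤-trans (#-pair y a) (#-≥-list (E? H a) (((y′≢y ∘ sym) ∷ []) ∷ [] ∷ []) (E-sym H ya ∷ E-sym H y′a ∷ [])))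
        (#-≥1 (E? H a) (E-sym H ya))

  module Pendant (supported : ∀ {y} → ¬ Leaf y → ∃ λ l → LeafAt y l) where

    private
      -- The non-leaves, which will be the vertices of F.
      xs : List (Vertex H)
      xs = filter (λ v → ¬? (leaf? v)) (allFin (order H))

      uxs : Unique xs
      uxs = Unique.filter⁺ (λ v → ¬? (leaf? v)) (Unique.allFin⁺ (order H))

      inner : Fin (length xs) → Vertex H
      inner = lookup xs

      inner-¬leaf : ∀ i → ¬ Leaf (inner i)
      inner-¬leaf i = proj₂ (∈-filter⁻ (λ v → ¬? (leaf? v)) {xs = allFin (order H)} (∈-lookup {xs = xs} i))

      inner-surjective : ∀ {v} → ¬ Leaf v → ∃ λ i → inner i ≡ v
      inner-surjective {v} ¬leaf = let v∈ = ∈-filter⁺ (λ v → ¬? (leaf? v)) (∈-allFin v) ¬leaf in index v∈ , sym (lookup-index v∈)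

      pendant : Fin (length xs) → Vertex H
      pendant i = proj₁ (supported (inner-¬leaf i))

      pendant-leaf : ∀ i → LeafAt (inner i) (pendant i)
      pendant-leaf i = proj₂ (supported (inner-¬leaf i))

      F : Graph
      F = record { order = length xs ; adj = λ i j → adj H (inner i) (inner j)
                 ; adj-sym = λ i j → adj-sym H (inner i) (inner j) ; adj-irrefl = λ i → adj-irrefl H (inner i) }

      -- A walk in H projects to F by replacing each leaf with its support.
      F-connected : Connected F
      F-connected i j = walk (conn (inner i) (inner j)) (inj₁ refl)
        where
        walk : ∀ {v j} → Reach H (inner i) v → v ≡ inner j ⊎ LeafAt (inner j) v → Reach F i j
        walk here (inj₁ eq) = subst (Reach F i) (lookup-injective uxs eq) here
        walk here (inj₂ lf) = contradiction (_ , lf) (inner-¬leaf i)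
        -- A walk can enter a leaf only from its support, so this step projects to staying in place.
        walk (step {v} p e) (inj₂ (_ , only)) = walk p (inj₁ (only v e))
        walk (step {v} p e) (inj₁ refl) with leaf? v
        ... | no ¬leaf = let k , eq = inner-surjective ¬leaf in step (walk p (inj₁ (sym eq))) (subst (λ t → E H t _) (sym eq) e)
        ... | yes (s , lf) = walk p (inj₂ (subst (λ t → LeafAt t v) (sym (proj₂ lf _ (E-sym H e))) lf))

      f′ : Fin (length xs) ⊎ Fin (length xs) → Vertex H
      f′ = [ inner , pendant ]′

      f′-injective : ∀ p q → f′ p ≡ f′ q → p ≡ q
      f′-injective (inj₁ i) (inj₁ j) eq = cong inj₁ (lookup-injective uxs eq)
      f′-injective (inj₁ i) (inj₂ j) eq = contradiction (_ , subst (LeafAt _) (sym eq) (pendant-leaf j)) (inner-¬leaf i)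
      f′-injective (inj₂ i) (inj₁ j) eq = contradiction (_ , subst (LeafAt _) eq (pendant-leaf i)) (inner-¬leaf j)
      f′-injective (inj₂ i) (inj₂ j) eq = cong inj₂ (lookup-injective uxs (proj₂ (pendant-leaf j) (inner i) (subst (E H (inner i)) eq (proj₁ (pendant-leaf i)))))

      f′-surjective : ∀ v → ∃ λ p → f′ p ≡ v
      f′-surjective v with leaf? v
      ... | no ¬leaf = let i , eq = inner-surjective ¬leaf in inj₁ i , eq
      ... | yes (s , lf) with inner-surjective (support-not-leaf conn 3≤n lf)
      ...   | i , refl = inj₂ i , leaf-unique (pendant-leaf i) lf

      pendant-adj : ∀ i j → adj H (inner i) (pendant j) ≡ ⌊ i ≟ j ⌋
      pendant-adj i j with i ≟ j
      ... | yes refl = proj₁ (pendant-leaf i)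
      ... | no i≢j = ¬-not (λ e → i≢j (lookup-injective uxs (proj₂ (pendant-leaf j) _ e)))

      f′-preserves : ∀ p q → adj H (f′ p) (f′ q) ≡ cadj F p q
      f′-preserves (inj₁ i) (inj₁ j) = refl
      f′-preserves (inj₁ i) (inj₂ j) = pendant-adj i j
      f′-preserves (inj₂ i) (inj₁ j) = trans (adj-sym H (pendant i) (inner j)) (trans (pendant-adj j i) (≟-sym j i))
      f′-preserves (inj₂ i) (inj₂ j) = ¬-not (λ e → inner-¬leaf j
        (_ , subst (LeafAt _) (proj₂ (pendant-leaf j) _ e) (pendant-leaf i)))

      k = length xs

      corona≅ : Corona F ≅ H
      corona≅ = bijection⇒≅ (f′ ∘ splitAt k)
        (λ {i} {j} eq → trans (sym (join-splitAt k k i)) (trans (cong (join k k) (f′-injective (splitAt k i) (splitAt k j) eq)) (join-splitAt k k j)))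
        (λ v → let p , eq = f′-surjective v in join k k p , trans (cong f′ (splitAt-join k k p)) eq)
        (λ i j → f′-preserves (splitAt k i) (splitAt k j))

      -- A leaf is dominated by its support. A non-leaf h has a neighbour other than its pendant
      -- leaf, and by uniqueness of that leaf this neighbour is not a leaf.
      total : ∀ h → ∃ λ t → ¬ Leaf t × E H t h
      total h with leaf? h
      ... | yes (s , lf) = s , support-not-leaf conn 3≤n lf , proj₁ lf
      ... | no ¬leaf =
        let l , hl , only = supported ¬leaf
            w , w≢l , wh = other-neighbour (λ lf → ¬leaf (l , lf)) (E-sym H hl)
        in w , (λ (t , lf) → w≢l (leaf-unique (subst (λ t → LeafAt t w) (sym (proj₂ lf h (E-sym H wh))) lf) (hl , only))) , wh

      leaves-independent : MaximalIndependent H Leaf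
      leaves-independent =
        (λ { {u} (s , lf) leaf e → support-not-leaf conn 3≤n lf (subst Leaf (proj₂ lf _ (E-sym H e)) leaf) }) ,
        λ v (¬leaf , none) → let l , lf = supported ¬leaf in none l (v , lf) (E-sym H (proj₁ lf))

      -- Every non-leaf carries a leaf, and a leaf has only one support.
      inner≤leaves : # (λ v → ¬? (leaf? v)) ≤ # leaf?
      inner≤leaves = ≤-trans (≤-reflexive (sym (*-identityˡ _))) (#-relation (λ v → ¬? (leaf? v)) leaf? leafAt? 1
        (λ {i} ¬leaf → #-≥1 (leafAt? i) (proj₂ (supported ¬leaf))) (λ _ lf → _ , lf) (λ _ _ (e , _) (_ , only) → only _ e))

    conclusion : Conclusion
    conclusion = inj₂ (F , F-connected , ≅-sym corona≅) ,
      λ G → total⇒¬tight G H (λ v → ¬? (leaf? v)) leaf? total leaves-independent inner≤leaves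
        (≤-trans (#-≥1 (λ v → ¬? (leaf? v)) (proj₁ (proj₂ (total (first 3≤n))))) inner≤leaves)
      where
      first : ∀ {n} → 3 ≤ n → Fin n
      first (s≤s _) = zero

  structure : Conclusion
  -- The dichotomy is whether some vertex is neither a leaf nor the support of one.
  structure with any? (λ y → ¬? (leaf? y) ×-dec all? (λ l → ¬? (leafAt? y l)))
  ... | yes (y , ¬leaf , no-leaf) = Cycle.conclusion ¬leaf no-leaf
  ... | no none = Pendant.conclusion supported
    where
    supported : ∀ {y} → ¬ Leaf y → ∃ λ l → LeafAt y l
    supported {y} ¬leaf with any? (leafAt? y)
    ... | yes p = p
    ... | no none′ = contradiction (y , ¬leaf , λ l lf → none′ (l , lf)) none

-- Isomorphisms and the classification

≅-trans : ∀ {X Y Z} → X ≅ Y → Y ≅ Z → X ≅ Z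
≅-trans p q = record
  { to = Q.to ∘ P.to ; from = P.from ∘ Q.from
  ; from-to = λ u → trans (cong P.from (Q.from-to (P.to u))) (P.from-to u)
  ; to-from = λ v → trans (cong Q.to (P.to-from (Q.from v))) (Q.to-from v)
  ; preserves = λ u v → trans (Q.preserves (P.to u) (P.to v)) (P.preserves u v) }
  where
  module P = _≅_ p
  module Q = _≅_ q

module _ {G H G′ H′ : Graph} (φ : Vertex G × Vertex H → Vertex G′ × Vertex H′) (ψ : Vertex G′ × Vertex H′ → Vertex G × Vertex H)
  (ψφ : ∀ p → ψ (φ p) ≡ p) (φψ : ∀ q → φ (ψ q) ≡ q) (pres : ∀ p q → padj G′ H′ (φ p) (φ q) ≡ padj G H p q) where

  pairs⇒≅ : (G ×ᵍ H) ≅ (G′ ×ᵍ H′)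
  pairs⇒≅ = record
    { to = λ i → enc′ (φ (dec i)) ; from = λ j → enc (ψ (dec′ j))
    ; from-to = λ i → trans (cong (enc ∘ ψ) (dec′-enc′ (φ (dec i)))) (trans (cong enc (ψφ (dec i))) (combine-remQuot {order G} (order H) i))
    ; to-from = λ j → trans (cong (enc′ ∘ φ) (remQuot-combine _ _)) (trans (cong enc′ (φψ (dec′ j))) (combine-remQuot {order G′} (order H′) j))
    ; preserves = λ i j → trans (cong₂ (padj G′ H′) (dec′-enc′ (φ (dec i))) (dec′-enc′ (φ (dec j)))) (pres (dec i) (dec j)) }
    where
    dec : Vertex (G ×ᵍ H) → Vertex G × Vertex H
    dec = remQuot (order H)
    dec′ : Vertex (G′ ×ᵍ H′) → Vertex G′ × Vertex H′
    dec′ = remQuot (order H′)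
    enc : Vertex G × Vertex H → Vertex (G ×ᵍ H)
    enc = uncurry combine
    enc′ : Vertex G′ × Vertex H′ → Vertex (G′ ×ᵍ H′)
    enc′ = uncurry combine
    dec′-enc′ : ∀ p → dec′ (enc′ p) ≡ p
    dec′-enc′ (g , h) = remQuot-combine g h

×ᵍ-cong : ∀ {G H G′ H′} → G ≅ G′ → H ≅ H′ → (G ×ᵍ H) ≅ (G′ ×ᵍ H′)
×ᵍ-cong {G} {H} {G′} {H′} p q = pairs⇒≅ {G} {H} {G′} {H′}
  (λ (g , h) → P.to g , Q.to h) (λ (g , h) → P.from g , Q.from h)
  (λ (g , h) → cong₂ _,_ (P.from-to g) (Q.from-to h)) (λ (g , h) → cong₂ _,_ (P.to-from g) (Q.to-from h))
  (λ (g , h) (g′ , h′) → cong₂ _∧_ (P.preserves g g′) (Q.preserves h h′))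
  where
  module P = _≅_ p
  module Q = _≅_ q

×ᵍ-comm : ∀ G H → (G ×ᵍ H) ≅ (H ×ᵍ G)
×ᵍ-comm G H = pairs⇒≅ {G} {H} {H} {G} swap swap (λ _ → refl) (λ _ → refl) (λ (g , h) (g′ , h′) → ∧-comm (adj H h h′) (adj G g g′))

clique⇒≅K : ∀ {n} G → order G ≡ n → Clique G U → G ≅ K n
clique⇒≅K G refl clique = record
  { to = λ u → u ; from = λ u → u ; from-to = λ _ → refl ; to-from = λ _ → refl ; preserves = pres }
  where
  pres : ∀ u v → not ⌊ u ≟ v ⌋ ≡ adj G u v
  pres u v with u ≟ v
  ... | yes refl = sym (adj-irrefl G u)
  ... | no u≢v = sym (clique tt tt u≢v)

order≡2⇒exhausted : ∀ G → order G ≡ 2 → ∀ {u v} → u ≢ v → ∀ w → w ∈ˡ u ∷ v ∷ []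
order≡2⇒exhausted G eq u≢v w = #-exhausted (U? (order G)) ((u≢v ∷ []) ∷ [] ∷ []) (tt ∷ tt ∷ []) (≤-reflexive (trans #U eq)) tt

order≡2⇒≅K2 : ∀ G → order G ≡ 2 → NoIsolated G U → G ≅ K 2
order≡2⇒≅K2 G eq iso = clique⇒≅K G eq clique
  where
  clique : Clique G U
  clique {u} {v} _ _ u≢v with iso {u} tt
  ... | w , _ , wu with order≡2⇒exhausted G eq u≢v w
  ...   | here refl = contradiction wu (E-irrefl G)
  ...   | there (here refl) = E-sym G wu

-- Places K₂ × K₂ in the corona family.
K2≅Corona : K 2 ≅ Corona (K 1)
K2≅Corona = record { to = λ u → u ; from = λ u → u ; from-to = λ _ → refl ; to-from = λ _ → refl ; preserves = pres }
  where
  pres : ∀ u v → adj (Corona (K 1)) u v ≡ adj (K 2) u v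
  pres zero zero = refl
  pres zero (suc zero) = refl
  pres (suc zero) zero = refl
  pres (suc zero) (suc zero) = refl

K1-connected : Connected (K 1)
K1-connected zero zero = here

Target : Graph → Set
Target X = (X ≅ (K 3 ×ᵍ K 3)) ⊎ (X ≅ (K 2 ×ᵍ C4)) ⊎ Σ Graph (λ F → Connected F × (X ≅ (K 2 ×ᵍ Corona F)))

target-≅ : ∀ {X Y} → X ≅ Y → Target Y → Target X
target-≅ p (inj₁ q) = inj₁ (≅-trans p q)
target-≅ p (inj₂ (inj₁ q)) = inj₂ (inj₁ (≅-trans p q))
target-≅ p (inj₂ (inj₂ (F , conn , q))) = inj₂ (inj₂ (F , conn , ≅-trans p q))

K2-target : ∀ {G H} → G ≅ K 2 → (H ≅ C4 ⊎ ∃ λ F → Connected F × H ≅ Corona F) → Target (G ×ᵍ H)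
K2-target p (inj₁ q) = inj₂ (inj₁ (×ᵍ-cong p q))
K2-target p (inj₂ (F , conn , q)) = inj₂ (inj₂ (F , conn , ×ᵍ-cong p q))

-- If neither order is 2, the structure of H excludes G. Otherwise one factor is K₂ and the
-- structure of the other one decides the case.
tight-layerBound⇒target : (G H : Graph) → Connected G → Connected H → 2 ≤ order G → 2 ≤ order H →
  Tight G H U U → LayerBound H → Target (G ×ᵍ H)
tight-layerBound⇒target G H connG connH 2≤G 2≤H tight bound = split (order G ℕ.≟ 2) (order H ℕ.≟ 2)
  where
  isoG = Leaves.connected⇒noIsolated G connG 2≤G
  isoH = Leaves.connected⇒noIsolated H connH 2≤H
  first : ∀ {n} → 2 ≤ n → Fin n
  first (s≤s _) = zero
  pairH : order H ≡ 2 → Pair H U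
  pairH eq = let u , _ , e = isoH {first 2≤H} tt in u , first 2≤H , tt , tt , e , λ _ → order≡2⇒exhausted H eq (E⇒≢ H e) _
  split : Dec (order G ≡ 2) → Dec (order H ≡ 2) → Target (G ×ᵍ H)
  split (yes G≡2) (yes H≡2) = K2-target (order≡2⇒≅K2 G G≡2 isoG)
    (inj₂ (K 1 , K1-connected , ≅-trans (order≡2⇒≅K2 H H≡2 isoH) K2≅Corona))
  -- Here H itself is an edge, which gives G a layer bound of its own with the roles exchanged.
  split (no G≢2) (yes H≡2) = target-≅ (×ᵍ-comm G H) (K2-target (order≡2⇒≅K2 H H≡2 isoH)
    (proj₁ (LayerStructure.structure G connG (≤∧≢⇒< 2≤G (G≢2 ∘ sym)) (pair⇒layerBound H G (pairH H≡2) isoG (tight-swap G H tight)))))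
  split (yes G≡2) (no H≢2) = K2-target (order≡2⇒≅K2 G G≡2 isoG)
    (proj₁ (LayerStructure.structure H connH (≤∧≢⇒< 2≤H (H≢2 ∘ sym)) bound))
  split (no G≢2) (no H≢2) = ⊥-elim
    (proj₂ (LayerStructure.structure H connH (≤∧≢⇒< 2≤H (H≢2 ∘ sym)) bound) G connG (≤∧≢⇒< 2≤G (G≢2 ∘ sym)) tight)

tight⇒target : (G H : Graph) → Connected G → Connected H → 2 ≤ order G → 2 ≤ order H → Tight G H U U → Target (G ×ᵍ H)
tight⇒target G H connG connH 2≤G 2≤H tight
  with Leaves.connected⇒noIsolated G connG 2≤G {first 2≤G} tt | Leaves.connected⇒noIsolated H connH 2≤H {first 2≤H} tt
  where
  first : ∀ {n} → 2 ≤ n → Fin n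
  first (s≤s _) = zero
... | _ , _ , eG | _ , _ , eH with multipartite-residual G eG | multipartite-residual H eH
...   | I , indI , edgeR@(_ , _ , ra , rb , ab) , multiR | J , indJ , edgeS , multiS = finish (tight-multipartite G H R? S? tightRS multiR multiS edgeR edgeS)
  where
  isoG = Leaves.connected⇒noIsolated G connG 2≤G
  isoH = Leaves.connected⇒noIsolated H connH 2≤H
  R? = residual? G (_∈? I)
  S? = residual? H (_∈? J)
  tight′ : Tight H G U U
  tight′ = tight-swap G H tight
  tightR : Tight G H (Residual G (_∈ I)) U
  tightR = tight-residual G H (_∈? I) (U? (order H)) indI isoH tight
  tightS : Tight H G (Residual H (_∈ J)) U
  tightS = tight-residual H G (_∈? J) (U? (order G)) indJ isoG tight′
  tightRS : Tight G H (Residual G (_∈ I)) (Residual H (_∈ J))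
  -- The second reduction has R as the cofactor, so R must have no isolated vertices. This holds as
  -- R is complete multipartite with an edge.
  tightRS = tight-swap H G (tight-residual H G (_∈? J) R? indJ (multipartite-noIsolated G multiR ra rb ab) (tight-swap G H tightR))
  finish : Pair G (Residual G (_∈ I)) ⊎ Pair H (Residual H (_∈ J)) ⊎ (Triangle G (Residual G (_∈ I)) × Triangle H (Residual H (_∈ J))) → Target (G ×ᵍ H)
  finish (inj₁ pair) = tight-layerBound⇒target G H connG connH 2≤G 2≤H tight (pair⇒layerBound G H pair isoH tightR)
  finish (inj₂ (inj₁ pair)) = target-≅ (×ᵍ-comm G H)
    (tight-layerBound⇒target H G connH connG 2≤H 2≤G tight′ (pair⇒layerBound H G pair isoG tightS))
  finish (inj₂ (inj₂ (triR , triS))) = inj₁ (×ᵍ-cong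
    (clique⇒≅K G (G₃.order≡3 connG (Triangle.a triR)) (G₃.complete connG))
    (clique⇒≅K H (H₃.order≡3 connH (Triangle.a triS)) (H₃.complete connH)))
    where
    -- The triangle found in each factor determines the other factor.
    module H₃ = TriangleFactor G H R? triR tightR isoH
    module G₃ = TriangleFactor H G S? triS tightS isoG

-- Well-domination of the listed products

module _ {X Y : Graph} (X≅Y : X ≅ Y) where

  open _≅_ X≅Y

  image : Subset (order X) → Subset (order Y)
  image D = subset (λ v → from v ∈? D)

  image-dominating : ∀ {D} → Dominating X D → Dominating Y (image D)
  image-dominating {D} dom v with dom (from v)
  ... | inj₁ v∈ = inj₁ (∈-subset⁺ (λ v → from v ∈? D) v∈)
  ... | inj₂ (u , u∈ , e) = inj₂ (to u , ∈-subset⁺ (λ v → from v ∈? D) (subst (_∈ D) (sym (from-to u)) u∈) ,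
      trans (cong (adj Y (to u)) (sym (to-from v))) (trans (preserves u (from v)) e))

  -- One inequality is enough, as the reverse one comes from the inverse isomorphism.
  ∣image∣ : ∀ D → ∣ image D ∣ ≤ ∣ D ∣
  ∣image∣ D = begin
    ∣ image D ∣                     ≡⟨ ∣subset∣ (λ v → from v ∈? D) ⟩
    # (λ v → from v ∈? D)           ≡⟨ *-identityˡ _ ⟨
    1 * # (λ v → from v ∈? D)       ≤⟨ #-relation (λ v → from v ∈? D) (_∈? D) (λ v u → u ≟ from v) 1
                                         (λ {v} _ → #-≥1 (_≟ from v) refl) (λ v∈ eq → subst (_∈ D) (sym eq) v∈)
                                         (λ {v} {w} _ _ p q → trans (sym (to-from v)) (trans (cong to (trans (sym p) q)) (to-from w))) ⟩
    # (_∈? D)                       ≡⟨ ∣∣≡# D ⟨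
    ∣ D ∣                           ∎
    where open ≤-Reasoning

wellDominated-≅ : ∀ {X Y} → X ≅ Y → WellDominated Y → WellDominated X
wellDominated-≅ {X} {Y} iso wd D (dom , minimal) = dom , λ D′ dom′ → begin
  ∣ D ∣                   ≤⟨ D≤ ⟩
  ∣ image iso D ∣         ≤⟨ proj₂ (wd (image iso D) (image-dominating iso dom , minimal′)) (image iso D′) (image-dominating iso dom′) ⟩
  ∣ image iso D′ ∣        ≤⟨ ∣image∣ iso D′ ⟩
  ∣ D′ ∣                  ∎
  where
  open ≤-Reasoning
  open _≅_ iso
  D≤ : ∣ D ∣ ≤ ∣ image iso D ∣
  D≤ = ≤-trans (≤-reflexive (∣∣≡# D)) (≤-trans (#-mono (_∈? D) (_∈? image (≅-sym iso) (image iso D))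
    (λ {u} u∈ → ∈-subset⁺ (λ u → to u ∈? image iso D) (∈-subset⁺ (λ v → from v ∈? D) (subst (_∈ D) (sym (from-to u)) u∈))))
    (≤-trans (≤-reflexive (sym (∣∣≡# (image (≅-sym iso) (image iso D))))) (∣image∣ (≅-sym iso) (image iso D))))
  minimal′ : ∀ D′ → D′ ⊂ image iso D → ¬ Dominating Y D′
  minimal′ D′ (D′⊆ , x , x∈ , x∉) dom′ = minimal (image (≅-sym iso) D′)
    ( (λ {u} u∈ → subst (_∈ D) (from-to u) (∈-subset⁻ (λ v → from v ∈? D) (D′⊆ (∈-subset⁻ (λ u → to u ∈? D′) u∈))))
    , from x , ∈-subset⁻ (λ v → from v ∈? D) x∈
    , λ fx∈ → x∉ (subst (_∈ D′) (to-from x) (∈-subset⁻ (λ u → to u ∈? D′) fx∈)) )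
    (image-dominating (≅-sym iso) dom′)

-- The closed neighbourhoods {s c , ℓ c} of the pendant vertices ℓ c partition the graph; a minimal
-- dominating set meets each of them exactly once.
module _ (X : Graph) {m : ℕ} (s ℓ : Fin m → Vertex X) (cell : Vertex X → Fin m)
  (in-cell : ∀ v → v ≡ s (cell v) ⊎ v ≡ ℓ (cell v)) (cell-s : ∀ c → cell (s c) ≡ c) (cell-ℓ : ∀ c → cell (ℓ c) ≡ c)
  (edge : ∀ c → E X (s c) (ℓ c)) (only : ∀ c v → E X v (ℓ c) → v ≡ s c) where

  pendant⇒wellDominated : WellDominated X
  pendant⇒wellDominated D (dom , minimal) = dom , λ D′ dom′ → begin
    ∣ D ∣              ≡⟨ ∣∣≡# D ⟩
    # (_∈? D)          ≡⟨ *-identityˡ _ ⟨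
    1 * # (_∈? D)      ≤⟨ #-relation (_∈? D) (U? m) (λ v c → c ≟ cell v) 1 (λ {v} _ → #-≥1 (_≟ cell v) refl) _
                            (λ v∈ w∈ p q → once v∈ w∈ (trans (sym p) q)) ⟩
    # (U? m)           ≡⟨ *-identityˡ _ ⟨
    1 * # (U? m)       ≤⟨ #-relation (U? m) (_∈? D′) (λ c v → v ∈? D′ ×-dec (cell v ≟ c)) 1
                            (λ {c} _ → let v , v∈ , eq = meets dom′ c in #-≥1 (λ v → v ∈? D′ ×-dec (cell v ≟ c)) {v} (v∈ , eq))
                            (λ _ (v∈ , _) → v∈) (λ _ _ (_ , p) (_ , q) → trans (sym p) q) ⟩
    # (_∈? D′)         ≡⟨ ∣∣≡# D′ ⟨
    ∣ D′ ∣             ∎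
    where
    open ≤-Reasoning
    meets : ∀ {D′} → Dominating X D′ → ∀ c → ∃ λ v → v ∈ D′ × cell v ≡ c
    meets dom′ c with dom′ (ℓ c)
    ... | inj₁ ℓ∈ = ℓ c , ℓ∈ , cell-ℓ c
    ... | inj₂ (u , u∈ , e) = u , u∈ , trans (cong cell (only c u e)) (cell-s c)
    -- If both were in D, then `ℓ c` could be dropped: its only neighbour is `s c`, which remains
    -- and dominates it.
    not-both : ∀ c → s c ∈ D → ¬ ℓ c ∈ D
    not-both c s∈ ℓ∈ = minimal D⁻
      ( (λ v∈ → proj₁ (∈-subset⁻ D⁻? v∈)) , ℓ c , ℓ∈ , λ ℓ∈⁻ → proj₂ (∈-subset⁻ D⁻? ℓ∈⁻) refl) dom⁻
      where
      D⁻? = λ v → v ∈? D ×-dec ¬? (v ≟ ℓ c)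
      D⁻ = subset D⁻?
      s∈⁻ : s c ∈ D⁻
      s∈⁻ = ∈-subset⁺ D⁻? (s∈ , E⇒≢ X (edge c))
      dom⁻ : Dominating X D⁻
      dom⁻ w with dom w
      ... | inj₁ w∈ with w ≟ ℓ c
      ...   | yes refl = inj₂ (s c , s∈⁻ , edge c)
      ...   | no w≢ = inj₁ (∈-subset⁺ D⁻? (w∈ , w≢))
      dom⁻ w | inj₂ (u , u∈ , e) with u ≟ ℓ c
      ...   | yes refl = inj₁ (subst (_∈ D⁻) (sym (only c w (E-sym X e))) s∈⁻)
      ...   | no u≢ = inj₂ (u , ∈-subset⁺ D⁻? (u∈ , u≢) , e)
    once : ∀ {v w} → v ∈ D → w ∈ D → cell v ≡ cell w → v ≡ w
    once {v} {w} v∈ w∈ eq with in-cell v | in-cell w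
    ... | inj₁ p | inj₁ q = trans p (trans (cong s eq) (sym q))
    ... | inj₂ p | inj₂ q = trans p (trans (cong ℓ eq) (sym q))
    ... | inj₁ p | inj₂ q = contradiction (subst (_∈ D) (trans q (cong ℓ (sym eq))) w∈) (not-both _ (subst (_∈ D) p v∈))
    ... | inj₂ p | inj₁ q = contradiction (subst (_∈ D) (trans p (cong ℓ eq)) v∈) (not-both _ (subst (_∈ D) q w∈))

module _ (F : Graph) where

  private
    k = order F
    X = K 2 ×ᵍ Corona F

    Code = Fin 2 × (Fin k ⊎ Fin k)

    decode : Vertex X → Code
    decode v = let i , p = remQuot (k + k) v in i , splitAt k p

    encode : Code → Vertex X
    encode (i , p) = combine i (join k k p)

    decode-encode : ∀ q → decode (encode q) ≡ q
    decode-encode (i , p) = trans (cong (λ (i , p) → i , splitAt k p) (remQuot-combine i (join k k p))) (cong (i ,_) (splitAt-join k k p))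

    encode-decode : ∀ v → encode (decode v) ≡ v
    encode-decode v = trans (cong (combine (proj₁ (remQuot {2} (k + k) v))) (join-splitAt k k (proj₂ (remQuot {2} (k + k) v)))) (combine-remQuot {2} (k + k) v)

    code-adj : Code → Code → Bool
    code-adj (i , p) (j , q) = not ⌊ i ≟ j ⌋ ∧ cadj F p q

    flip : Fin 2 → Fin 2
    flip zero = suc zero
    flip (suc zero) = zero

    flip-flip : ∀ i → flip (flip i) ≡ i
    flip-flip zero = refl
    flip-flip (suc zero) = refl

    -- In the product, the only neighbour of (i , u′) is (`flip i` , u), so (`flip i` , u) indexes
    -- the cell of both.
    cell′ : Code → Fin 2 × Fin k
    cell′ (i , inj₁ u) = i , u
    cell′ (i , inj₂ u) = flip i , u

    s′ ℓ′ : Fin 2 × Fin k → Code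
    s′ (i , u) = i , inj₁ u
    ℓ′ (i , u) = flip i , inj₂ u

    cell′-ℓ′ : ∀ c → cell′ (ℓ′ c) ≡ c
    cell′-ℓ′ (i , u) = cong (_, u) (flip-flip i)

    in-cell′ : ∀ q → q ≡ s′ (cell′ q) ⊎ q ≡ ℓ′ (cell′ q)
    in-cell′ (i , inj₁ u) = inj₁ refl
    in-cell′ (i , inj₂ u) = inj₂ (cong (_, inj₂ u) (sym (flip-flip i)))

    edge′ : ∀ c → code-adj (s′ c) (ℓ′ c) ≡ true
    edge′ (zero , u) = ≟-refl u
    edge′ (suc zero , u) = ≟-refl u

    only′ : ∀ c q → code-adj q (ℓ′ c) ≡ true → q ≡ s′ c
    only′ (zero , u) (zero , inj₁ v) e with v ≟ u
    ... | yes refl = refl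
    only′ (zero , u) (zero , inj₂ v) ()
    only′ (zero , u) (suc zero , p) ()
    only′ (suc zero , u) (suc zero , inj₁ v) e with v ≟ u
    ... | yes refl = refl
    only′ (suc zero , u) (suc zero , inj₂ v) ()
    only′ (suc zero , u) (zero , p) ()

    s ℓ : Fin (2 * k) → Vertex X
    s c = encode (s′ (remQuot k c))
    ℓ c = encode (ℓ′ (remQuot k c))

    cell : Vertex X → Fin (2 * k)
    cell v = uncurry combine (cell′ (decode v))

    rq-cell : ∀ v → remQuot k (cell v) ≡ cell′ (decode v)
    rq-cell v = remQuot-combine (proj₁ (cell′ (decode v))) (proj₂ (cell′ (decode v)))

    cell-encode : ∀ (f : Fin 2 × Fin k → Code) → (∀ c → cell′ (f c) ≡ c) → ∀ c → cell (encode (f (remQuot k c))) ≡ c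
    cell-encode f eq c = trans (cong (uncurry combine ∘ cell′) (decode-encode (f (remQuot k c))))
      (trans (cong (uncurry combine) (eq (remQuot k c))) (combine-remQuot {2} k c))

    in-cell : ∀ v → v ≡ s (cell v) ⊎ v ≡ ℓ (cell v)
    in-cell v with in-cell′ (decode v)
    ... | inj₁ eq = inj₁ (trans (sym (encode-decode v)) (trans (cong encode eq) (cong (encode ∘ s′) (sym (rq-cell v)))))
    ... | inj₂ eq = inj₂ (trans (sym (encode-decode v)) (trans (cong encode eq) (cong (encode ∘ ℓ′) (sym (rq-cell v)))))

    edge : ∀ c → E X (s c) (ℓ c)
    edge c = trans (cong₂ code-adj (decode-encode (s′ (remQuot k c))) (decode-encode (ℓ′ (remQuot k c)))) (edge′ (remQuot k c))

    only : ∀ c v → E X v (ℓ c) → v ≡ s c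
    only c v e = trans (sym (encode-decode v)) (cong encode (only′ (remQuot k c) (decode v)
      (trans (cong (code-adj (decode v)) (sym (decode-encode (ℓ′ (remQuot k c))))) e)))

  K2×Corona-wellDominated : WellDominated X
  K2×Corona-wellDominated = pendant⇒wellDominated X s ℓ cell in-cell (cell-encode s′ (λ _ → refl)) (cell-encode ℓ′ cell′-ℓ′) edge only

module _ (X : Graph) where

  dominating? : ∀ D → Dec (Dominating X D)
  dominating? D = all? (λ v → v ∈? D ⊎-dec any? (λ u → u ∈? D ×-dec E? X u v))

  -- When this holds for all D, every dominating set has at least `γ` vertices and any larger one
  -- has a removable vertex. Minimal ones then have exactly `γ`.
  Balanced : ℕ → Subset (order X) → Set
  Balanced γ D = Dominating X D → γ ≤ ∣ D ∣ × (∣ D ∣ ≤ γ ⊎ ∃ λ x → x ∈ D × Dominating X (D - x))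

  balanced? : ∀ γ D → Dec (Balanced γ D)
  balanced? γ D = dominating? D →-dec (γ ≤? ∣ D ∣) ×-dec ((∣ D ∣ ≤? γ) ⊎-dec any? (λ x → x ∈? D ×-dec dominating? (D - x)))

  balanced⇒wellDominated : ∀ γ → ¬ (∃ λ D → ¬ Balanced γ D) → WellDominated X
  balanced⇒wellDominated γ none D (dom , minimal) = dom , λ D′ dom′ → ≤-trans
    ([ (λ D≤γ → D≤γ) , (λ (x , x∈ , dom⁻) → contradiction dom⁻ (minimal (D - x) (x∈p⇒p-x⊂p x∈))) ]′ (proj₂ (balanced D dom)))
    (proj₁ (balanced D′ dom′))
    where
    balanced : ∀ D → Balanced γ D
    balanced D = decidable-stable (balanced? γ D) (λ ¬b → none (D , ¬b))

-- Decided by running through all subsets. The value 4 arises because the product is two disjoint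
-- 4-cycles, each with domination number 2.
K2×C4-wellDominated : WellDominated (K 2 ×ᵍ C4)
K2×C4-wellDominated = balanced⇒wellDominated (K 2 ×ᵍ C4) 4 (from-no (anySubset? (λ D → ¬? (balanced? (K 2 ×ᵍ C4) 4 D))))

-- The same exhaustive check; the value 3 is attained by the diagonal.
K3×K3-wellDominated : WellDominated (K 3 ×ᵍ K 3)
K3×K3-wellDominated = balanced⇒wellDominated (K 3 ×ᵍ K 3) 3 (from-no (anySubset? (λ D → ¬? (balanced? (K 3 ×ᵍ K 3) 3 D))))

target⇒wellDominated : ∀ {X} → Target X → WellDominated X
target⇒wellDominated (inj₁ iso) = wellDominated-≅ iso K3×K3-wellDominated
target⇒wellDominated (inj₂ (inj₁ iso)) = wellDominated-≅ iso K2×C4-wellDominated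
target⇒wellDominated (inj₂ (inj₂ (F , _ , iso))) = wellDominated-≅ iso (K2×Corona-wellDominated F)

theorem2 : (G H : Graph) → Connected G → Connected H → 2 ≤ order G → 2 ≤ order H →
    (WellDominated (G ×ᵍ H) ⇔
    (((G ×ᵍ H) ≅ (K 3 ×ᵍ K 3)) ⊎ ((G ×ᵍ H) ≅ (K 2 ×ᵍ C4)) ⊎
    Σ Graph (λ F → Connected F × ((G ×ᵍ H) ≅ (K 2 ×ᵍ Corona F)))))
theorem2 G H connG connH 2≤G 2≤H =
  mk⇔ (λ wd → tight⇒target G H connG connH 2≤G 2≤H (wellDominated⇒tight G H wd)) target⇒wellDominated
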